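{- Let $k$ be a positive integer. Let $K_1, K_2, \dots, K_k$ be distinct real quadratic fields. Then there exists a positive integer $n$ such that $I_{2n}^{2,r}$ contains a primitive element (over $\mathbb{Q}$) of every $K_i$, $i \in \{1,2,\dots,k\}$.
   Context: A real quadratic field is a subfield of $\mathbb{R}$ of degree two over $\mathbb{Q}$. For an integer $n \ge 1$, $$I_n^{2,r} := \{\alpha \in (0,1) \mid \alpha^2+n\alpha+c=0 \text{ for some } c \in \mathbb{Z},\ -n \le c \le -1\}.$$ -}

module Defs where

open import Level using (Level; 0ℓ) renaming (suc to lsuc)
open import Data.Nat.Base as ℕ using (ℕ)
import Data.Nat.Properties as ℕ
open import Data.Integer.Base as ℤ using (ℤ)
open import Data.Rational.Base as ℚ using (ℚ; 0ℚ; 1ℚ; ½)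
import Data.Rational.Properties as ℚ
open import Data.Rational.Solver using (module +-*-Solver)
open import Data.Fin.Base using (Fin)
open import Data.Vec.Functional using (Vector; foldr)
open import Data.Product.Base using (∃-syntax; _×_; _,_)
open import Relation.Unary using (Pred; _∈_; _≐_)
open import Relation.Binary.PropositionalEquality
  using (_≡_; refl; sym; trans; cong; cong₂; subst)

-- There are no quotients: ℝ is a setoid, with equality _≃_.

CauchySeq : (ℕ → ℚ) → Set
CauchySeq x = ∀ ε → 0ℚ ℚ.< ε →
  ∃[ N ] (∀ m n → N ℕ.≤ m → N ℕ.≤ n → ℚ.∣ x m ℚ.- x n ∣ ℚ.< ε)

record ℝ : Set where
  constructor mkℝ
  field
    seq    : ℕ → ℚ
    cauchy : CauchySeq seq

open ℝ public

infix 4 _≃_ _<_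

_≃_ : ℝ → ℝ → Set
x ≃ y = ∀ ε → 0ℚ ℚ.< ε →
  ∃[ N ] (∀ n → N ℕ.≤ n → ℚ.∣ seq x n ℚ.- seq y n ∣ ℚ.< ε)

_<_ : ℝ → ℝ → Set
x < y = ∃[ δ ] 0ℚ ℚ.< δ × ∃[ N ] (∀ n → N ℕ.≤ n → seq x n ℚ.+ δ ℚ.< seq y n)

-- The proof terms are abstract because unfolding them is very slow; only the
-- underlying sequences ever matter.

private
  abstract

    half-pos : ∀ {ε} → 0ℚ ℚ.< ε → 0ℚ ℚ.< ½ ℚ.* ε
    half-pos ε>0 = ℚ.*-monoʳ-<-pos ½ ε>0

    half+half : ∀ ε → ½ ℚ.* ε ℚ.+ ½ ℚ.* ε ≡ ε
    half+half ε = trans (sym (ℚ.*-distribʳ-+ ε ½ ½)) (ℚ.*-identityˡ ε)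

    m≤⊔ˡ : ∀ {M N n} → M ℕ.⊔ N ℕ.≤ n → M ℕ.≤ n
    m≤⊔ˡ {M} {N} = ℕ.≤-trans (ℕ.m≤m⊔n M N)

    m≤⊔ʳ : ∀ {M N n} → M ℕ.⊔ N ℕ.≤ n → N ℕ.≤ n
    m≤⊔ʳ {M} {N} = ℕ.≤-trans (ℕ.m≤n⊔m M N)

    const-cauchy : ∀ q → CauchySeq (λ _ → q)
    const-cauchy q ε ε>0 =
      0 , λ _ _ _ _ → subst (λ t → ℚ.∣ t ∣ ℚ.< ε) (sym (ℚ.+-inverseʳ q)) ε>0

    neg-cauchy : ∀ x → CauchySeq x → CauchySeq (λ n → ℚ.- x n)
    neg-cauchy x cx ε ε>0 with cx ε ε>0
    ... | N , close = N , λ m n N≤m N≤n →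
      subst (ℚ._< ε)
        (trans (sym (ℚ.∣-p∣≡∣p∣ (x m ℚ.- x n)))
               (cong ℚ.∣_∣ (ℚ.neg-distrib-+ (x m) (ℚ.- x n))))
        (close m n N≤m N≤n)

    +-cauchy : ∀ x y → CauchySeq x → CauchySeq y → CauchySeq (λ n → x n ℚ.+ y n)
    +-cauchy x y cx cy ε ε>0
      with cx (½ ℚ.* ε) (half-pos ε>0) | cy (½ ℚ.* ε) (half-pos ε>0)
    ... | M , closeX | N , closeY = M ℕ.⊔ N , λ m n ≤m ≤n → begin-strict
      ℚ.∣ (x m ℚ.+ y m) ℚ.- (x n ℚ.+ y n) ∣
        ≡⟨ cong ℚ.∣_∣ (rearrange (x m) (y m) (x n) (y n)) ⟩
      ℚ.∣ (x m ℚ.- x n) ℚ.+ (y m ℚ.- y n) ∣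
        ≤⟨ ℚ.∣p+q∣≤∣p∣+∣q∣ (x m ℚ.- x n) (y m ℚ.- y n) ⟩
      ℚ.∣ x m ℚ.- x n ∣ ℚ.+ ℚ.∣ y m ℚ.- y n ∣
        <⟨ ℚ.+-mono-< (closeX m n (m≤⊔ˡ ≤m) (m≤⊔ˡ ≤n))
                      (closeY m n (m≤⊔ʳ {M} ≤m) (m≤⊔ʳ {M} ≤n)) ⟩
      ½ ℚ.* ε ℚ.+ ½ ℚ.* ε
        ≡⟨ half+half ε ⟩
      ε ∎
      where
      open ℚ.≤-Reasoning
      rearrange : ∀ a b c d →
        (a ℚ.+ b) ℚ.- (c ℚ.+ d) ≡ (a ℚ.- c) ℚ.+ (b ℚ.- d)
      rearrange = solve 4 (λ a b c d →
        (a :+ b) :- (c :+ d) := (a :- c) :+ (b :- d)) refl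
        where open +-*-Solver

    cauchy⇒bounded : ∀ x → CauchySeq x →
      ∃[ B ] 0ℚ ℚ.< B × ∃[ N ] (∀ n → N ℕ.≤ n → ℚ.∣ x n ∣ ℚ.≤ B)
    cauchy⇒bounded x cx with cx 1ℚ (ℚ.positive⁻¹ 1ℚ)
    ... | N , close =
      1ℚ ℚ.+ ℚ.∣ x N ∣ ,
      ℚ.+-mono-<-≤ (ℚ.positive⁻¹ 1ℚ) (ℚ.0≤∣p∣ (x N)) ,
      N , λ n N≤n → begin
        ℚ.∣ x n ∣
          ≡⟨ cong ℚ.∣_∣ (split (x n) (x N)) ⟩
        ℚ.∣ (x n ℚ.- x N) ℚ.+ x N ∣
          ≤⟨ ℚ.∣p+q∣≤∣p∣+∣q∣ (x n ℚ.- x N) (x N) ⟩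
        ℚ.∣ x n ℚ.- x N ∣ ℚ.+ ℚ.∣ x N ∣
          ≤⟨ ℚ.+-monoˡ-≤ ℚ.∣ x N ∣ (ℚ.<⇒≤ (close n N N≤n ℕ.≤-refl)) ⟩
        1ℚ ℚ.+ ℚ.∣ x N ∣ ∎
      where
      open ℚ.≤-Reasoning
      split : ∀ a b → a ≡ (a ℚ.- b) ℚ.+ b
      split = solve 2 (λ a b → a := (a :- b) :+ b) refl
        where open +-*-Solver

    scale-down : ∀ {B ε} → 0ℚ ℚ.< B → 0ℚ ℚ.< ε → ∃[ δ ] 0ℚ ℚ.< δ × B ℚ.* δ ≡ ε
    scale-down {B} {ε} B>0 ε>0 = B⁻¹ ℚ.* ε , δ>0 , Bδ≡ε
      where
      instance
        posB : ℚ.Positive B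
        posB = ℚ.positive B>0
        nzB : ℚ.NonZero B
        nzB = ℚ.pos⇒nonZero B
      B⁻¹ : ℚ
      B⁻¹ = ℚ.1/ B
      δ>0 : 0ℚ ℚ.< B⁻¹ ℚ.* ε
      δ>0 = subst (ℚ._< B⁻¹ ℚ.* ε) (ℚ.*-zeroʳ B⁻¹)
        (ℚ.*-monoʳ-<-pos B⁻¹ {{ℚ.1/pos⇒pos B}} ε>0)
      Bδ≡ε : B ℚ.* (B⁻¹ ℚ.* ε) ≡ ε
      Bδ≡ε = trans (sym (ℚ.*-assoc B B⁻¹ ε))
        (trans (cong (ℚ._* ε) (ℚ.*-inverseʳ B)) (ℚ.*-identityˡ ε))

    bounded*small : ∀ {B δ} p q → 0ℚ ℚ.< B →
      ℚ.∣ p ∣ ℚ.≤ B → ℚ.∣ q ∣ ℚ.< δ → ℚ.∣ p ℚ.* q ∣ ℚ.< B ℚ.* δ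
    bounded*small {B} {δ} p q B>0 p≤B q<δ = begin-strict
      ℚ.∣ p ℚ.* q ∣          ≡⟨ ℚ.∣p*q∣≡∣p∣*∣q∣ p q ⟩
      ℚ.∣ p ∣ ℚ.* ℚ.∣ q ∣    ≤⟨ ℚ.*-monoʳ-≤-nonNeg ℚ.∣ q ∣
                                  {{ℚ.nonNegative (ℚ.0≤∣p∣ q)}} p≤B ⟩
      B ℚ.* ℚ.∣ q ∣          <⟨ ℚ.*-monoʳ-<-pos B {{ℚ.positive B>0}} q<δ ⟩
      B ℚ.* δ                ∎
      where open ℚ.≤-Reasoning

    product-close : ∀ {B C δ η ε} a b c d → 0ℚ ℚ.< B → 0ℚ ℚ.< C →
      ℚ.∣ a ∣ ℚ.≤ B → ℚ.∣ d ∣ ℚ.≤ C →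
      ℚ.∣ a ℚ.- c ∣ ℚ.< δ → ℚ.∣ b ℚ.- d ∣ ℚ.< η →
      B ℚ.* η ≡ ½ ℚ.* ε → C ℚ.* δ ≡ ½ ℚ.* ε →
      ℚ.∣ a ℚ.* b ℚ.- c ℚ.* d ∣ ℚ.< ε
    product-close {B} {C} {δ} {η} {ε} a b c d B>0 C>0 a≤B d≤C a~c b~d Bη≡ Cδ≡ =
      begin-strict
      ℚ.∣ a ℚ.* b ℚ.- c ℚ.* d ∣
        ≡⟨ cong ℚ.∣_∣ (rearrange a b c d) ⟩
      ℚ.∣ a ℚ.* (b ℚ.- d) ℚ.+ d ℚ.* (a ℚ.- c) ∣
        ≤⟨ ℚ.∣p+q∣≤∣p∣+∣q∣ (a ℚ.* (b ℚ.- d)) (d ℚ.* (a ℚ.- c)) ⟩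
      ℚ.∣ a ℚ.* (b ℚ.- d) ∣ ℚ.+ ℚ.∣ d ℚ.* (a ℚ.- c) ∣
        <⟨ ℚ.+-mono-< (bounded*small a (b ℚ.- d) B>0 a≤B b~d)
                      (bounded*small d (a ℚ.- c) C>0 d≤C a~c) ⟩
      B ℚ.* η ℚ.+ C ℚ.* δ
        ≡⟨ cong₂ ℚ._+_ Bη≡ Cδ≡ ⟩
      ½ ℚ.* ε ℚ.+ ½ ℚ.* ε
        ≡⟨ half+half ε ⟩
      ε ∎
      where
      open ℚ.≤-Reasoning
      rearrange : ∀ a b c d →
        a ℚ.* b ℚ.- c ℚ.* d ≡ a ℚ.* (b ℚ.- d) ℚ.+ d ℚ.* (a ℚ.- c)
      rearrange = solve 4 (λ a b c d →
        a :* b :- c :* d := a :* (b :- d) :+ d :* (a :- c)) refl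
        where open +-*-Solver

    *-cauchy : ∀ x y → CauchySeq x → CauchySeq y → CauchySeq (λ n → x n ℚ.* y n)
    *-cauchy x y cx cy ε ε>0 =
      let B , B>0 , N₁ , x≤B  = cauchy⇒bounded x cx
          C , C>0 , N₂ , y≤C  = cauchy⇒bounded y cy
          δ , δ>0 , Cδ≡       = scale-down C>0 (half-pos ε>0)
          η , η>0 , Bη≡       = scale-down B>0 (half-pos ε>0)
          N₃ , closeX         = cx δ δ>0
          N₄ , closeY         = cy η η>0
      in (N₁ ℕ.⊔ N₂) ℕ.⊔ (N₃ ℕ.⊔ N₄) , λ m n ≤m ≤n →
         product-close (x m) (y m) (x n) (y n) B>0 C>0
           (x≤B m (m≤⊔ˡ (m≤⊔ˡ ≤m)))
           (y≤C n (m≤⊔ʳ {N₁} (m≤⊔ˡ ≤n)))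
           (closeX m n (m≤⊔ˡ (m≤⊔ʳ {N₁ ℕ.⊔ N₂} ≤m)) (m≤⊔ˡ (m≤⊔ʳ {N₁ ℕ.⊔ N₂} ≤n)))
           (closeY m n (m≤⊔ʳ {N₃} (m≤⊔ʳ {N₁ ℕ.⊔ N₂} ≤m))
                       (m≤⊔ʳ {N₃} (m≤⊔ʳ {N₁ ℕ.⊔ N₂} ≤n)))
           Bη≡ Cδ≡

infixl 6 _+_
infixl 7 _*_
infix  8 -_

_+_ : ℝ → ℝ → ℝ
x + y = mkℝ (λ n → seq x n ℚ.+ seq y n) (+-cauchy (seq x) (seq y) (cauchy x) (cauchy y))

_*_ : ℝ → ℝ → ℝ
x * y = mkℝ (λ n → seq x n ℚ.* seq y n) (*-cauchy (seq x) (seq y) (cauchy x) (cauchy y))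

-_ : ℝ → ℝ
- x = mkℝ (λ n → ℚ.- seq x n) (neg-cauchy (seq x) (cauchy x))

fromℚ : ℚ → ℝ
fromℚ q = mkℝ (λ _ → q) (const-cauchy q)

fromℤ : ℤ → ℝ
fromℤ z = fromℚ (z ℚ./ 1)

0ℝ 1ℝ : ℝ
0ℝ = fromℚ 0ℚ
1ℝ = fromℚ 1ℚ

-- Closure under inverses is stated relationally, x * y ≃ 1ℝ meaning that
-- y is the inverse of x; this needs no choice of a notion of nonzero.

record IsSubfield {ℓ : Level} (K : Pred ℝ ℓ) : Set ℓ where
  field
    resp-≃     : ∀ {x y} → x ≃ y → x ∈ K → y ∈ K
    0-closed   : 0ℝ ∈ K
    1-closed   : 1ℝ ∈ K
    +-closed   : ∀ {x y} → x ∈ K → y ∈ K → x + y ∈ K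
    neg-closed : ∀ {x} → x ∈ K → - x ∈ K
    *-closed   : ∀ {x y} → x ∈ K → y ∈ K → x * y ∈ K
    ⁻¹-closed  : ∀ {x y} → x * y ≃ 1ℝ → x ∈ K → y ∈ K

linComb : ∀ {d} → Vector ℚ d → Vector ℝ d → ℝ
linComb a b = foldr _+_ 0ℝ (λ i → fromℚ (a i) * b i)

record IsℚBasis {ℓ : Level} (K : Pred ℝ ℓ) {d : ℕ} (b : Vector ℝ d) : Set ℓ where
  field
    members     : ∀ i → b i ∈ K
    spanning    : ∀ {x} → x ∈ K → ∃[ a ] x ≃ linComb a b
    independent : ∀ a → linComb a b ≃ 0ℝ → ∀ i → a i ≡ 0ℚ

HasDegree : {ℓ : Level} → Pred ℝ ℓ → ℕ → Set ℓ
HasDegree K d = ∃[ b ] IsℚBasis K {d} b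

record RealQuadraticField (ℓ : Level) : Set (lsuc ℓ) where
  field
    elements   : Pred ℝ ℓ
    isSubfield : IsSubfield elements
    degree-2   : HasDegree elements 2

open RealQuadraticField public using (elements)

data ℚ⟮_⟯ (α : ℝ) : Pred ℝ 0ℓ where
  generator : α ∈ ℚ⟮ α ⟯
  rational  : ∀ q → fromℚ q ∈ ℚ⟮ α ⟯
  resp-≃    : ∀ {x y} → x ≃ y → x ∈ ℚ⟮ α ⟯ → y ∈ ℚ⟮ α ⟯
  plus      : ∀ {x y} → x ∈ ℚ⟮ α ⟯ → y ∈ ℚ⟮ α ⟯ → x + y ∈ ℚ⟮ α ⟯
  negate    : ∀ {x} → x ∈ ℚ⟮ α ⟯ → - x ∈ ℚ⟮ α ⟯
  times     : ∀ {x y} → x ∈ ℚ⟮ α ⟯ → y ∈ ℚ⟮ α ⟯ → x * y ∈ ℚ⟮ α ⟯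
  inverse   : ∀ {x y} → x * y ≃ 1ℝ → x ∈ ℚ⟮ α ⟯ → y ∈ ℚ⟮ α ⟯

IsPrimitiveElement : {ℓ : Level} → ℝ → RealQuadraticField ℓ → Set ℓ
IsPrimitiveElement α K = elements K ≐ ℚ⟮ α ⟯

I²ʳ : ℕ → Pred ℝ 0ℓ
I²ʳ n α = (0ℝ < α × α < 1ℝ) ×
  ∃[ c ] (ℤ.- (ℤ.+ n) ℤ.≤ c × c ℤ.≤ ℤ.-1ℤ) ×
         α * α + fromℤ (ℤ.+ n) * α + fromℤ c ≃ 0ℝ

{-# OPTIONS --safe #-}

-- Each Kᵢ is ℚ(√dᵢ) for some non-square positive integer dᵢ, and
-- α = m√dᵢ - n satisfies α² + 2nα + (n² - dᵢm²) = 0. So it suffices to find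
-- n and mᵢ with n² < dᵢmᵢ² < (n+1)² for all i.
--
-- In ℤ[t₁,…,t_k]/(tᵢ² - dᵢ) the square of y = Σ_S b_S t_S, where S ranges over
-- the subsets of {1,…,k}, has constant coefficient a = Σ_S d_S b_S² and
-- tᵢ-coefficient aᵢ = 2 Σ_{S∌i} d_S b_S b_{S∪i}, so that
--
--   a - aᵢ√dᵢ = Σ_{S∌i} d_S (b_S - b_{S∪i}√dᵢ)² ≥ 0.
--
-- Dirichlet's theorem provides integers b_S so close to q ∏_{j∉S} √dⱼ, for one
-- q ≥ 1, that all these sums are < 1; then n = a - 1 and mᵢ = aᵢ will do. In
-- the estimates √dᵢ is replaced by a rational s/τ slightly below it, whose
-- precision can be fixed in advance because q is bounded.
module Submission where

open import Data.Integer.Tactic.RingSolver using (solve-∀)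
open import Data.Nat.Base as ℕ using (ℕ; zero; suc; z≤n; s≤s)
import Data.Nat.DivMod as ℕ
import Data.Nat.Properties as ℕ
open import Data.Product.Base using (∃-syntax; _×_; _,_; proj₁; proj₂; swap)
open import Relation.Binary.Definitions using (tri<; tri≈; tri>)
open import Relation.Binary.PropositionalEquality
open import Relation.Nullary.Decidable.Core using (yes; no)
open import Relation.Nullary.Negation using (¬_; contradiction)

-- The obstacle is the sign. Approximation can make every |mᵢ√dᵢ - n| small for one n, but the
-- differences mᵢ√dᵢ - n must also be positive for all i at once. The square y² settles this: a -
-- aᵢ√dᵢ is nonnegative whatever the signs of the approximation errors, so aᵢ√dᵢ lies just below a,
-- that is, between a - 1 and a.
--
-- The targets for b_S are the coefficients of q ∏ⱼ (tⱼ + √dⱼ). Setting tᵢ = -√dᵢ kills this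
-- product, for each i, and turns y into Σ_{S∌i} (b_S - b_{S∪i}√dᵢ) t_S. The coefficients of the
-- latter are therefore pure approximation error, and a - aᵢ√dᵢ is the constant coefficient of its
-- square.

module Hypercube where

  open import Data.Bool.Base using (Bool; true; false)
  open import Data.Fin.Base as Fin using (Fin; zero; suc; punchIn)
  import Data.Fin.Properties as Fin
  open import Data.Integer.Base hiding (suc)
  open import Data.Integer.DivMod using (_/ℕ_; _%ℕ_; n%ℕd<d; a≡a%ℕn+[a/ℕn]*n)
  open import Data.Integer.Properties
  open import Data.Vec.Base using (Vec; []; _∷_; insertAt; replicate)
  open import Data.Vec.Functional using (tail; removeAt)

  -- Inequalities between integers

  -- Nonlinear inequalities are proved by certificates: the difference of the two sides is written
  -- as a sum of products of nonnegative factors, and the ring solver checks the identity.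
  ≤-by : ∀ {x y} z → 0ℤ ≤ z → y ≡ x + z → x ≤ y
  ≤-by {x} z 0≤z refl = i≤i+j x z {{nonNegative 0≤z}}

  0≤-+ : ∀ {x y} → 0ℤ ≤ x → 0ℤ ≤ y → 0ℤ ≤ x + y
  0≤-+ = +-mono-≤

  0≤-* : ∀ {x y} → 0ℤ ≤ x → 0ℤ ≤ y → 0ℤ ≤ x * y
  0≤-* {x} {y} 0≤x 0≤y =
    subst (_≤ x * y) (*-zeroʳ x) (*-monoˡ-≤-nonNeg x {{nonNegative 0≤x}} 0≤y)

  0≤+ : ∀ n → 0ℤ ≤ + n
  0≤+ n = +≤+ z≤n

  0≤-sq : ∀ x → 0ℤ ≤ x * x
  0≤-sq (+ n)    = 0≤-* {+ n} {+ n} (+≤+ z≤n) (+≤+ z≤n)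
  0≤-sq -[1+ n ] = +≤+ z≤n

  *-cancelˡ-≤ : ∀ {c x y} → 0ℤ < c → c * x ≤ c * y → x ≤ y
  *-cancelˡ-≤ {c} 0<c = *-cancelˡ-≤-pos _ _ c {{positive 0<c}}

  0<-* : ∀ {x y} → 0ℤ < x → 0ℤ < y → 0ℤ < x * y
  0<-* {x} {y} 0<x 0<y =
    subst (_< x * y) (*-zeroʳ x) (*-monoˡ-<-pos x {{positive 0<x}} 0<y)

  isqrt : ∀ n → ∃[ s ] (s ℕ.* s ℕ.≤ n × n ℕ.≤ s ℕ.* s ℕ.+ (s ℕ.+ s))
  isqrt zero = 0 , z≤n , z≤n
  isqrt (suc n) with isqrt n
  ... | s , s²≤n , n≤s²+2s with n ℕ.≟ s ℕ.* s ℕ.+ (s ℕ.+ s)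
  ...   | no  n≢ = s , ℕ.m≤n⇒m≤1+n s²≤n , ℕ.≤∧≢⇒< n≤s²+2s n≢
  ...   | yes n≡ =
    suc s , ℕ.≤-reflexive (sym 1+n≡) , ℕ.≤-trans (ℕ.≤-reflexive 1+n≡) (ℕ.m≤m+n _ _)
    where
    1+n≡ : suc n ≡ suc s ℕ.* suc s
    1+n≡ = cong suc (trans n≡ (trans (sym (ℕ.+-assoc (s ℕ.* s) s s))
      (trans (ℕ.+-comm (s ℕ.* s ℕ.+ s) s)
        (cong (s ℕ.+_) (trans (ℕ.+-comm (s ℕ.* s) s) (sym (ℕ.*-suc s s)))))))

  sq-diff-≤ : ∀ {r r′ t} → 0ℤ ≤ r → r ≤ t → 0ℤ ≤ r′ → r′ ≤ t →
    (r - r′) * (r - r′) ≤ t * t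
  sq-diff-≤ {r} {r′} {t} 0≤r r≤t 0≤r′ r′≤t =
    ≤-by _ (0≤-* (0≤-+ (i≤j⇒0≤j-i r≤t) 0≤r′) (0≤-+ 0≤r (i≤j⇒0≤j-i r′≤t)))
      (identity r r′ t)
    where
    identity : ∀ r r′ t →
      t * t ≡ (r - r′) * (r - r′) + ((t - r) + r′) * (r + (t - r′))
    identity = solve-∀

  sq-scale-≤ : ∀ {u v} w → 0ℤ ≤ u → u ≤ v → (u * w) * (u * w) ≤ (v * w) * (v * w)
  sq-scale-≤ {u} {v} w 0≤u u≤v =
    ≤-by _ (0≤-* (0≤-* (i≤j⇒0≤j-i u≤v) (0≤-+ 0≤u (≤-trans 0≤u u≤v))) (0≤-sq w))
      (identity u v w)
    where
    identity : ∀ u v w →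
      (v * w) * (v * w) ≡ (u * w) * (u * w) + ((v - u) * (u + v)) * (w * w)
    identity = solve-∀

  -- Simultaneous Diophantine approximation

  -- |q p x / T - b x| ≤ 1 / N, squared and cleared of denominators.
  Approximates : ∀ {A : Set} (N T : ℕ) (p : A → ℤ) (q : ℕ) (b : A → ℤ) → Set
  Approximates N T p q b = ∀ x →
    (+ N * (+ q * p x - b x * + T)) * (+ N * (+ q * p x - b x * + T)) ≤ + T * + T

  -- Pigeonhole on the N + 1 multiples j p with 0 ≤ j ≤ N, sorted by which of N equal parts of [0,
  -- T) contains the residue modulo T. Two residues in the same part differ by less than T / N, and
  -- the difference of the two multipliers serves as q.
  dirichlet₁ : ∀ N .{{_ : ℕ.NonZero N}} T .{{_ : ℕ.NonZero T}} (p : ℤ) →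
    ∃[ q ] (1 ℕ.≤ q × q ℕ.≤ N) × ∃[ b ]
      (+ N * (+ q * p - b * + T)) * (+ N * (+ q * p - b * + T)) ≤ + T * + T
  dirichlet₁ N T p with Fin.pigeonhole (ℕ.n<1+n N) box
    where
    rem : Fin (suc N) → ℕ
    rem j = (+ Fin.toℕ j * p) %ℕ T
    box : Fin (suc N) → Fin N
    box j = Fin.fromℕ< {(N ℕ.* rem j) ℕ./ T}
      (ℕ.m<n*o⇒m/o<n (ℕ.*-monoʳ-< N (n%ℕd<d (+ Fin.toℕ j * p) T)))
  ... | i , j , i<j , box≡ =
    Fin.toℕ j ℕ.∸ Fin.toℕ i ,
    (ℕ.m<n⇒0<n∸m i<j , ℕ.≤-trans (ℕ.m∸n≤m (Fin.toℕ j) (Fin.toℕ i)) (ℕ.s≤s⁻¹ (Fin.toℕ<n j))) ,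
    (quot j - quot i) ,
    subst (λ t → t * t ≤ + T * + T) (sym error≡)
      (sq-diff-≤ (+≤+ z≤n) (+≤+ (ℕ.<⇒≤ (ℕ.m%n<n (N ℕ.* rem j) T)))
                 (+≤+ z≤n) (+≤+ (ℕ.<⇒≤ (ℕ.m%n<n (N ℕ.* rem i) T))))
    where
    rem : Fin (suc N) → ℕ
    rem j = (+ Fin.toℕ j * p) %ℕ T
    quot : Fin (suc N) → ℤ
    quot j = (+ Fin.toℕ j * p) /ℕ T
    w : ℕ
    w = (N ℕ.* rem i) ℕ./ T
    w≡ : (N ℕ.* rem j) ℕ./ T ≡ w
    w≡ = sym (Fin.fromℕ<-injective _ _ _ _ box≡)
    scaled : ∀ l → + N * + rem l ≡ + ((N ℕ.* rem l) ℕ.% T) + + ((N ℕ.* rem l) ℕ./ T) * + T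
    scaled l = trans (sym (pos-* N (rem l)))
      (trans (cong +_ (ℕ.m≡m%n+[m/n]*n (N ℕ.* rem l) T))
        (trans (pos-+ ((N ℕ.* rem l) ℕ.% T) _)
          (cong (λ t → + ((N ℕ.* rem l) ℕ.% T) + t) (pos-* ((N ℕ.* rem l) ℕ./ T) T))))
    q≡ : + (Fin.toℕ j ℕ.∸ Fin.toℕ i) ≡ + Fin.toℕ j - + Fin.toℕ i
    q≡ = trans (sym (⊖-≥ (ℕ.<⇒≤ i<j))) (sym (m-n≡m⊖n (Fin.toℕ j) (Fin.toℕ i)))
    error≡ : + N * (+ (Fin.toℕ j ℕ.∸ Fin.toℕ i) * p - (quot j - quot i) * + T) ≡
             + ((N ℕ.* rem j) ℕ.% T) - + ((N ℕ.* rem i) ℕ.% T)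
    error≡ = begin
      + N * (+ (Fin.toℕ j ℕ.∸ Fin.toℕ i) * p - (quot j - quot i) * + T)
        ≡⟨ cong (λ t → + N * (t * p - (quot j - quot i) * + T)) q≡ ⟩
      + N * ((+ Fin.toℕ j - + Fin.toℕ i) * p - (quot j - quot i) * + T)
        ≡⟨ identity₁ (+ N) (+ Fin.toℕ j) (+ Fin.toℕ i) p (quot j) (quot i) (+ T) ⟩
      + N * (+ Fin.toℕ j * p - + Fin.toℕ i * p - (quot j - quot i) * + T)
        ≡⟨ cong₂ (λ x y → + N * (x - y - (quot j - quot i) * + T))
             (a≡a%ℕn+[a/ℕn]*n (+ Fin.toℕ j * p) T) (a≡a%ℕn+[a/ℕn]*n (+ Fin.toℕ i * p) T) ⟩
      + N * ((+ rem j + quot j * + T) - (+ rem i + quot i * + T) - (quot j - quot i) * + T)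
        ≡⟨ identity₂ (+ N) (+ rem j) (+ rem i) (quot j) (quot i) (+ T) ⟩
      + N * + rem j - + N * + rem i
        ≡⟨ cong₂ _-_
             (trans (scaled j) (cong (λ t → + ((N ℕ.* rem j) ℕ.% T) + + t * + T) w≡)) (scaled i) ⟩
      (+ ((N ℕ.* rem j) ℕ.% T) + + w * + T) - (+ ((N ℕ.* rem i) ℕ.% T) + + w * + T)
        ≡⟨ identity₃ (+ ((N ℕ.* rem j) ℕ.% T)) (+ ((N ℕ.* rem i) ℕ.% T)) (+ w * + T) ⟩
      + ((N ℕ.* rem j) ℕ.% T) - + ((N ℕ.* rem i) ℕ.% T) ∎
      where
      open ≡-Reasoning
      identity₁ : ∀ n x y p u v t →
        n * ((x - y) * p - (u - v) * t) ≡ n * (x * p - y * p - (u - v) * t)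
      identity₁ = solve-∀
      identity₂ : ∀ n x y u v t →
        n * ((x + u * t) - (y + v * t) - (u - v) * t) ≡ n * x - n * y
      identity₂ = solve-∀
      identity₃ : ∀ x y z → (x + z) - (y + z) ≡ x - y
      identity₃ = solve-∀

  -- Q must not depend on T: with q = T the statement would be trivial, and of no use.
  dirichlet : ∀ k N .{{_ : ℕ.NonZero N}} → ∃[ Q ] (∀ T .{{_ : ℕ.NonZero T}}
    (p : Vec Bool k → ℤ) → ∃[ q ] (1 ℕ.≤ q × q ℕ.≤ Q) × ∃[ b ] Approximates N T p q b)
  dirichlet zero N = N , λ T p → let q , q-bounds , b , close = dirichlet₁ N T (p []) in
    q , q-bounds , (λ _ → b) , λ { [] → close }
  dirichlet (suc k) N =
    let Q₂ , approx₂ = dirichlet k N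
        -- The two halves of the cube are approximated one after the other, the second for numbers
        -- already multiplied by q₁, so that q₁ q₂ serves both. The errors of the first half then
        -- grow by the factor q₂ ≤ Q₂, which the finer precision N (Q₂ + 1) absorbs.
        Q₁ , approx₁ = dirichlet k (N ℕ.* suc Q₂) {{ℕ.m*n≢0 N (suc Q₂)}}
    in Q₁ ℕ.* Q₂ , λ T p →
    let q₁ , (1≤q₁ , q₁≤Q₁) , b₁ , close₁ = approx₁ T (λ S → p (false ∷ S))
        q₂ , (1≤q₂ , q₂≤Q₂) , b₂ , close₂ = approx₂ T (λ S → + q₁ * p (true ∷ S))
    in q₁ ℕ.* q₂ , (ℕ.*-mono-≤ 1≤q₁ 1≤q₂ , ℕ.*-mono-≤ q₁≤Q₁ q₂≤Q₂) ,
       (λ { (false ∷ S) → + q₂ * b₁ S ; (true ∷ S) → b₂ S }) ,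
       λ { (false ∷ S) → scaled-close Q₂ T q₁ q₂ (p (false ∷ S)) (b₁ S) q₂≤Q₂ (close₁ S)
         ; (true ∷ S) → subst
             (λ t → (+ N * (t - b₂ S * + T)) * (+ N * (t - b₂ S * + T)) ≤ + T * + T)
             (reassociate q₁ q₂ (p (true ∷ S))) (close₂ S) }
    where
    identity₁ : ∀ x y z → y * (x * z) ≡ (x * y) * z
    identity₁ = solve-∀
    reassociate : ∀ q₁ q₂ z → + q₂ * (+ q₁ * z) ≡ + (q₁ ℕ.* q₂) * z
    reassociate q₁ q₂ z = trans (identity₁ (+ q₁) (+ q₂) z) (cong (_* z) (sym (pos-* q₁ q₂)))
    scaled-close : ∀ Q₂ T q₁ q₂ z b → q₂ ℕ.≤ Q₂ →
      (+ (N ℕ.* suc Q₂) * (+ q₁ * z - b * + T)) * (+ (N ℕ.* suc Q₂) * (+ q₁ * z - b * + T))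
        ≤ + T * + T →
      (+ N * (+ (q₁ ℕ.* q₂) * z - (+ q₂ * b) * + T)) *
        (+ N * (+ (q₁ ℕ.* q₂) * z - (+ q₂ * b) * + T)) ≤ + T * + T
    scaled-close Q₂ T q₁ q₂ z b q₂≤Q₂ close = ≤-trans
      (subst (λ t → t * t ≤ (+ (N ℕ.* suc Q₂) * δ) * (+ (N ℕ.* suc Q₂) * δ)) error≡
        (sq-scale-≤ δ (+≤+ z≤n) (+≤+ (ℕ.*-monoʳ-≤ N (ℕ.m≤n⇒m≤1+n q₂≤Q₂)))))
      close
      where
      δ = + q₁ * z - b * + T
      identity₂ : ∀ n x y z b t →
        (n * y) * (x * z - b * t) ≡ n * ((x * y) * z - (y * b) * t)
      identity₂ = solve-∀
      error≡ : + (N ℕ.* q₂) * δ ≡ + N * (+ (q₁ ℕ.* q₂) * z - (+ q₂ * b) * + T)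
      error≡ = trans (cong (_* δ) (pos-* N q₂))
        (trans (identity₂ (+ N) (+ q₁) (+ q₂) z b (+ T))
          (cong (λ t → + N * (t * z - (+ q₂ * b) * + T)) (sym (pos-* q₁ q₂))))

  -- Weighted sums over subsets

  -- weighted d f is the sum over all S of (∏_{i ∈ S} d i) * f S.
  weighted : ∀ {k} → (Fin k → ℕ) → (Vec Bool k → ℤ) → ℤ
  weighted {zero}  d f = f []
  weighted {suc k} d f =
    weighted (tail d) (λ S → f (false ∷ S)) + + d zero * weighted (tail d) (λ S → f (true ∷ S))

  weighted-cong : ∀ {k} (d : Fin k → ℕ) {f g} → (∀ S → f S ≡ g S) → weighted d f ≡ weighted d g
  weighted-cong {zero}  d f≡g = f≡g []
  weighted-cong {suc k} d f≡g = cong₂ (λ x y → x + + d zero * y)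
    (weighted-cong (tail d) (λ S → f≡g (false ∷ S)))
    (weighted-cong (tail d) (λ S → f≡g (true ∷ S)))

  weighted-mono : ∀ {k} (d : Fin k → ℕ) {f g} → (∀ S → f S ≤ g S) → weighted d f ≤ weighted d g
  weighted-mono {zero}  d f≤g = f≤g []
  weighted-mono {suc k} d f≤g = +-mono-≤
    (weighted-mono (tail d) (λ S → f≤g (false ∷ S)))
    (*-monoˡ-≤-nonNeg (+ d zero) (weighted-mono (tail d) (λ S → f≤g (true ∷ S))))

  weighted-+ : ∀ {k} (d : Fin k → ℕ) f g →
    weighted d (λ S → f S + g S) ≡ weighted d f + weighted d g
  weighted-+ {zero}  d f g = refl
  weighted-+ {suc k} d f g = trans
    (cong₂ (λ x y → x + + d zero * y)
      (weighted-+ (tail d) (λ S → f (false ∷ S)) (λ S → g (false ∷ S)))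
      (weighted-+ (tail d) (λ S → f (true ∷ S)) (λ S → g (true ∷ S))))
    (interchange (+ d zero)
      (weighted (tail d) (λ S → f (false ∷ S))) (weighted (tail d) (λ S → g (false ∷ S)))
      (weighted (tail d) (λ S → f (true ∷ S))) (weighted (tail d) (λ S → g (true ∷ S))))
    where
    interchange : ∀ c w x y z → (w + x) + c * (y + z) ≡ (w + c * y) + (x + c * z)
    interchange = solve-∀

  weighted-* : ∀ {k} (d : Fin k → ℕ) c f → weighted d (λ S → c * f S) ≡ c * weighted d f
  weighted-* {zero}  d c f = refl
  weighted-* {suc k} d c f = trans
    (cong₂ (λ x y → x + + d zero * y)
      (weighted-* (tail d) c (λ S → f (false ∷ S)))
      (weighted-* (tail d) c (λ S → f (true ∷ S))))
    (factor (+ d zero) c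
      (weighted (tail d) (λ S → f (false ∷ S))) (weighted (tail d) (λ S → f (true ∷ S))))
    where
    factor : ∀ e c x y → c * x + e * (c * y) ≡ c * (x + e * y)
    factor = solve-∀

  -- The recursion of `weighted` exposes only the first coordinate, while every i must be singled
  -- out in turn. A vector S over the other indices stands for a set without i; its two insertions
  -- are S and S ∪ i.
  weighted-split : ∀ {k} (d : Fin (suc k) → ℕ) i f → weighted d f ≡
    weighted (removeAt d i) (λ S → f (insertAt S i false)) +
    + d i * weighted (removeAt d i) (λ S → f (insertAt S i true))
  weighted-split d zero f = refl
  weighted-split {suc k} d (suc i) f = trans
    (cong₂ (λ x y → x + + d zero * y)
      (weighted-split (tail d) i (λ S → f (false ∷ S)))
      (weighted-split (tail d) i (λ S → f (true ∷ S))))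
    (interchange (+ d zero) (+ d (suc i))
      (part false false) (part false true) (part true false) (part true true))
    where
    part : Bool → Bool → ℤ
    part x y = weighted (removeAt (tail d) i) (λ S → f (x ∷ insertAt S i y))
    interchange : ∀ c e w x y z →
      (w + e * x) + c * (y + e * z) ≡ (w + c * y) + e * (x + c * z)
    interchange = solve-∀

  weighted-nonNeg : ∀ {k} (d : Fin k → ℕ) {f} → (∀ S → 0ℤ ≤ f S) → 0ℤ ≤ weighted d f
  weighted-nonNeg {zero}  d 0≤f = 0≤f []
  weighted-nonNeg {suc k} d 0≤f = 0≤-+ (weighted-nonNeg (tail d) (λ S → 0≤f (false ∷ S)))
    (0≤-* (0≤+ (d zero)) (weighted-nonNeg (tail d) (λ S → 0≤f (true ∷ S))))

  full : ∀ {k} → Vec Bool k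
  full = replicate _ true

  insertAt-full : ∀ {k} (i : Fin (suc k)) → insertAt full i true ≡ full
  insertAt-full zero = refl
  insertAt-full {suc k} (suc i) = cong (true ∷_) (insertAt-full i)

  -- The weight of the full set is a product of numbers ≥ 1, and the other terms are nonnegative. So
  -- one nonzero numerator, that of the full set, suffices to bound sums of squares away from 0.
  weighted-full : ∀ {k} (d : Fin k → ℕ) {f} → (∀ i → 1 ℕ.≤ d i) → (∀ S → 0ℤ ≤ f S) →
    f full ≤ weighted d f
  weighted-full {zero}  d 1≤d 0≤f = ≤-refl
  weighted-full {suc k} d {f} 1≤d 0≤f = begin
    f full
      ≤⟨ weighted-full (tail d) (λ i → 1≤d (suc i)) (λ S → 0≤f (true ∷ S)) ⟩
    high
      ≤⟨ ≤-by _ (0≤-+ (weighted-nonNeg (tail d) (λ S → 0≤f (false ∷ S)))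
          (0≤-* (i≤j⇒0≤j-i (+≤+ (1≤d zero))) (weighted-nonNeg (tail d) (λ S → 0≤f (true ∷ S)))))
          (identity low high (+ d zero)) ⟩
    low + + d zero * high ∎
    where
    open ≤-Reasoning
    low  = weighted (tail d) (λ S → f (false ∷ S))
    high = weighted (tail d) (λ S → f (true ∷ S))
    identity : ∀ l h c → l + c * h ≡ h + (l + (c - 1ℤ) * h)
    identity = solve-∀

  -- Products of approximate square roots

  -- With s i / τ ≈ √(d i), rootProduct s τ S / τ ^ k ≈ ∏_{i ∉ S} √(d i).
  rootProduct : ∀ {k} → (Fin k → ℕ) → ℕ → Vec Bool k → ℤ
  rootProduct s τ []          = 1ℤ
  rootProduct s τ (false ∷ S) = + s zero * rootProduct (tail s) τ S
  rootProduct s τ (true  ∷ S) = + τ * rootProduct (tail s) τ S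

  x*yz≡y*xz : ∀ x y z → x * (y * z) ≡ y * (x * z)
  x*yz≡y*xz = solve-∀

  -- The two products differ in the factor at i alone, `s i` against `τ`. Rounding each root once,
  -- before multiplying, keeps this relation exact; approximating each product separately would
  -- spoil it.
  rootProduct-insertAt : ∀ {k} (s : Fin (suc k) → ℕ) τ i S →
    + τ * rootProduct s τ (insertAt S i false) ≡ + s i * rootProduct s τ (insertAt S i true)
  rootProduct-insertAt s τ zero S = x*yz≡y*xz (+ τ) (+ s zero) (rootProduct (tail s) τ S)
  rootProduct-insertAt s τ (suc i) (x ∷ S) = step x
    where
    r₀ = rootProduct (tail s) τ (insertAt S i false)
    r₁ = rootProduct (tail s) τ (insertAt S i true)
    through : ∀ c → + τ * (c * r₀) ≡ + s (suc i) * (c * r₁)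
    through c = trans (x*yz≡y*xz (+ τ) c r₀)
      (trans (cong (c *_) (rootProduct-insertAt (tail s) τ i S)) (x*yz≡y*xz c (+ s (suc i)) r₁))
    step : ∀ x → + τ * rootProduct s τ (x ∷ insertAt S i false) ≡
                 + s (suc i) * rootProduct s τ (x ∷ insertAt S i true)
    step false = through (+ s zero)
    step true  = through (+ τ)

  rootProduct-full : ∀ {k} (s : Fin k → ℕ) τ → rootProduct s τ full ≡ + (τ ℕ.^ k)
  rootProduct-full {zero}  s τ = refl
  rootProduct-full {suc k} s τ =
    trans (cong (+ τ *_) (rootProduct-full (tail s) τ)) (sym (pos-* τ (τ ℕ.^ k)))

  -- The square of the approximated product is at most the product of the d j over j ∉ S, hence at
  -- most ∏ⱼ (1 + d j), which is what the weights sum to.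
  rootProduct-bound : ∀ {k} (d s : Fin k → ℕ) τ →
    (∀ i → + s i * + s i ≤ + τ * + τ * + d i) → ∀ S →
    rootProduct s τ S * rootProduct s τ S ≤
      + (τ ℕ.^ k) * + (τ ℕ.^ k) * weighted d (λ _ → 1ℤ)
  rootProduct-bound {zero} d s τ s≤ [] = ≤-refl
  rootProduct-bound {suc k} d s τ s≤ (x ∷ S) =
    subst (λ t → rootProduct s τ (x ∷ S) * rootProduct s τ (x ∷ S) ≤ t * t * (w + + d zero * w))
      (sym (pos-* τ (τ ℕ.^ k))) (step x)
    where
    r = rootProduct (tail s) τ S
    T = + (τ ℕ.^ k)
    w = weighted (tail d) (λ _ → 1ℤ)
    r²≤ : r * r ≤ T * T * w
    r²≤ = rootProduct-bound (tail d) (tail s) τ (λ i → s≤ (suc i)) S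
    0≤w : 0ℤ ≤ w
    0≤w = weighted-nonNeg (tail d) (λ _ → +≤+ z≤n)
    identity₀ : ∀ c t d T w r → (t * T) * (t * T) * (w + d * w) ≡
      (c * r) * (c * r) + (c * c * (T * T * w - r * r) +
        ((t * t * d - c * c) * (T * T * w) + t * t * (T * T) * w))
    identity₀ = solve-∀
    identity₁ : ∀ t d T w r → (t * T) * (t * T) * (w + d * w) ≡
      (t * r) * (t * r) + (t * t * (T * T * w - r * r) + t * t * (T * T) * (d * w))
    identity₁ = solve-∀
    step : ∀ x → rootProduct s τ (x ∷ S) * rootProduct s τ (x ∷ S) ≤
      (+ τ * T) * (+ τ * T) * (w + + d zero * w)
    step false = ≤-by _
      (0≤-+ (0≤-* (0≤-sq (+ s zero)) (i≤j⇒0≤j-i r²≤))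
        (0≤-+ (0≤-* (i≤j⇒0≤j-i (s≤ zero)) (0≤-* (0≤-sq T) 0≤w))
              (0≤-* (0≤-* (0≤-sq (+ τ)) (0≤-sq T)) 0≤w)))
      (identity₀ (+ s zero) (+ τ) (+ d zero) T w r)
    step true = ≤-by _
      (0≤-+ (0≤-* (0≤-sq (+ τ)) (i≤j⇒0≤j-i r²≤))
            (0≤-* (0≤-* (0≤-sq (+ τ)) (0≤-sq T)) (0≤-* (0≤+ (d zero)) 0≤w)))
      (identity₁ (+ τ) (+ d zero) T w r)

  -- Bounds on errors and numerators

  -- The errors of b₀ and b₁ combine without a main term because τ p₀ = s p₁.
  edge-bound : ∀ N T τ s q p₀ p₁ b₀ b₁ → 0ℤ < T → τ * p₀ ≡ s * p₁ →
    (N * (q * p₀ - b₀ * T)) * (N * (q * p₀ - b₀ * T)) ≤ T * T →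
    (N * (q * p₁ - b₁ * T)) * (N * (q * p₁ - b₁ * T)) ≤ T * T →
    (N * N) * ((τ * b₀ - s * b₁) * (τ * b₀ - s * b₁)) ≤ + 2 * (s * s + τ * τ)
  edge-bound N T τ s q p₀ p₁ b₀ b₁ 0<T τp₀≡sp₁ close₀ close₁ =
    *-cancelˡ-≤ (0<-* 0<T 0<T) (≤-by _
      (0≤-+ (0≤-* (0≤-* (0≤+ 2) (0≤-sq s)) (i≤j⇒0≤j-i close₁))
        (0≤-+ (0≤-* (0≤-* (0≤+ 2) (0≤-sq τ)) (i≤j⇒0≤j-i close₀))
              -- This square is what (x - y)² ≤ 2 x² + 2 y² gives away.
              (0≤-sq (N * (s * δ₁ + τ * δ₀)))))
      (trans (identity N T τ s δ₀ δ₁)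
        (cong (_+ (+ 2 * (s * s) * (T * T - (N * δ₁) * (N * δ₁)) +
                  (+ 2 * (τ * τ) * (T * T - (N * δ₀) * (N * δ₀)) +
                   (N * (s * δ₁ + τ * δ₀)) * (N * (s * δ₁ + τ * δ₀)))))
          (trans (cong (λ t → (N * N) * (t * t)) (sym T*edge≡))
            (rescale N T (τ * b₀ - s * b₁))))))
    where
    δ₀ = q * p₀ - b₀ * T
    δ₁ = q * p₁ - b₁ * T
    expand : ∀ T τ s q p₀ p₁ b₀ b₁ → T * (τ * b₀ - s * b₁) ≡
      s * (q * p₁ - b₁ * T) - τ * (q * p₀ - b₀ * T) + q * (τ * p₀ - s * p₁)
    expand = solve-∀
    T*edge≡ : T * (τ * b₀ - s * b₁) ≡ s * δ₁ - τ * δ₀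
    T*edge≡ = trans (expand T τ s q p₀ p₁ b₀ b₁)
      (trans (cong (λ t → s * δ₁ - τ * δ₀ + q * t) (i≡j⇒i-j≡0 τp₀≡sp₁))
        (trans (cong (λ t → s * δ₁ - τ * δ₀ + t) (*-zeroʳ q)) (+-identityʳ _)))
    identity : ∀ N T τ s x y → (T * T) * (+ 2 * (s * s + τ * τ)) ≡
      (N * N) * ((s * y - τ * x) * (s * y - τ * x)) +
        (+ 2 * (s * s) * (T * T - (N * y) * (N * y)) +
         (+ 2 * (τ * τ) * (T * T - (N * x) * (N * x)) +
          (N * (s * y + τ * x)) * (N * (s * y + τ * x))))
    identity = solve-∀
    rescale : ∀ N T e → (N * N) * ((T * e) * (T * e)) ≡ (T * T) * ((N * N) * (e * e))
    rescale = solve-∀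

  -- Here b T is q p minus an error of absolute value at most T, and (x - y)² ≤ 2 x² + 2 y². The
  -- resulting bound does not involve T, so `τ` can be chosen large in comparison with it.
  numerator-bound : ∀ N T q Q p b W → 0ℤ < T → 1ℤ ≤ N → 0ℤ ≤ q → q ≤ Q →
    p * p ≤ T * T * W → (N * (q * p - b * T)) * (N * (q * p - b * T)) ≤ T * T →
    b * b ≤ + 2 * (Q * Q * W) + + 2
  numerator-bound N T q Q p b W 0<T 1≤N 0≤q q≤Q p²≤ close =
    *-cancelˡ-≤ (0<-* 0<T 0<T) (≤-by _
      (0≤-+ (0≤-* (0≤+ 2)
        (0≤-+ (i≤j⇒0≤j-i close)
          (0≤-+ (0≤-* (0≤-* (i≤j⇒0≤j-i 1≤N) (0≤-+ (≤-trans (0≤+ 1) 1≤N) (0≤+ 1)))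
                    (0≤-sq (q * p - b * T)))
            (0≤-+ (0≤-* (0≤-sq Q) (i≤j⇒0≤j-i p²≤))
              (0≤-* (0≤-* (i≤j⇒0≤j-i q≤Q) (0≤-+ 0≤q (≤-trans 0≤q q≤Q))) (0≤-sq p))))))
        (0≤-sq (+ 2 * (q * p) - b * T)))
      (identity N T q Q p b W))
    where
    identity : ∀ N T q Q p b W → (T * T) * (+ 2 * (Q * Q * W) + + 2) ≡ (T * T) * (b * b) +
      (+ 2 * ((T * T - (N * (q * p - b * T)) * (N * (q * p - b * T))) +
        ((N - 1ℤ) * (N + 1ℤ) * ((q * p - b * T) * (q * p - b * T)) +
          (Q * Q * (T * T * W - p * p) + (Q - q) * (q + Q) * (p * p)))) +
       (+ 2 * (q * p) - b * T) * (+ 2 * (q * p) - b * T))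
    identity = solve-∀

  -- Squeezing d m² between consecutive squares

  -- This reduces the estimates to three numbers X, Y, Z. The pair (τ, s) gives the total edge error
  -- E; the pair (aᵢ, a) gives the nonnegative form behind the upper bound.
  weighted-quadratic : ∀ {k} (d : Fin k → ℕ) (u v : ℤ) (x y : Vec Bool k → ℤ) →
    weighted d (λ S → (u * x S - v * y S) * (u * x S - v * y S)) ≡
    u * u * weighted d (λ S → x S * x S) +
    (v * v * weighted d (λ S → y S * y S) + (- (+ 2 * (u * v))) * weighted d (λ S → x S * y S))
  weighted-quadratic d u v x y = trans
    (weighted-cong d (λ S → expand u v (x S) (y S)))
    (trans (weighted-+ d (λ S → u * u * xx S) (λ S → v * v * yy S + c * xy S))
      (cong₂ _+_ (weighted-* d (u * u) xx)
        (trans (weighted-+ d (λ S → v * v * yy S) (λ S → c * xy S))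
          (cong₂ _+_ (weighted-* d (v * v) yy) (weighted-* d c xy)))))
    where
    c = - (+ 2 * (u * v))
    xx = λ S → x S * x S
    yy = λ S → y S * y S
    xy = λ S → x S * y S
    expand : ∀ u v x y → (u * x - v * y) * (u * x - v * y) ≡
      u * u * (x * x) + (v * v * (y * y) + (- (+ 2 * (u * v))) * (x * y))
    expand = solve-∀

  -- Here and in squeeze, X, Y and Z are the sums over S ∌ i, with weights d_S, of
  -- b_S², b_{S∪i}² and b_S b_{S∪i}, so that a = X + d Y and aᵢ = 2 Z, and E is
  -- that of (τ b_S - s b_{S∪i})². As s/τ ≤ √d, the claim gives a - 1 < aᵢ √d.
  lower-estimate : ∀ W M w τ s d X Y Z E →
    W ≡ w + d * w → E ≡ τ * τ * X + (s * s * Y + (- (+ 2 * (τ * s))) * Z) →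
    1ℤ ≤ W → 0ℤ ≤ M → 0ℤ ≤ w → 0ℤ < τ → 0ℤ ≤ s → 0ℤ ≤ d → 0ℤ ≤ Y → 0ℤ ≤ E →
    + 4 * (W * M) < τ → s * s ≤ τ * τ * d → τ * τ * d ≤ s * s + (s + s) → s ≤ τ * d →
    Y ≤ w * M → (W + W) * (W + W) * E ≤ + 2 * (s * s + τ * τ) * w →
    τ * (X + d * Y - 1ℤ) < s * (+ 2 * Z)
  lower-estimate _ M w τ s d X Y Z _ refl refl
    1≤W 0≤M 0≤w 0<τ 0≤s 0≤d 0≤Y 0≤E 4WM<τ s²≤ ≤s²+2s s≤τd Y≤ E≤ =
    -- Multiplied by τ, the claim reads E + (τ²d - s²) Y < τ². Each term gets half of τ²: E ≤ W E ≤
    -- τ² / 2 by the approximation, and (τ²d - s²) Y ≤ 2 s Y ≤ 2 τ d w M ≤ 2 τ W M < τ² / 2 by the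
    -- size of τ. The factor 2 clears the halves.
    *-cancelˡ-<-nonNeg (+ 2 * τ) {{nonNegative (<⇒≤ 0<2τ)}} (<-by
      (+-mono-<-≤ (0<-* 0<τ (m<n⇒0<n-m 4WM<τ))
        (0≤-+ (i≤j⇒0≤j-i 2WE≤)
          (0≤-+ (0≤-* (0≤+ 2) (0≤-* (i≤j⇒0≤j-i 1≤W) 0≤E))
            (0≤-+ (0≤-* (0≤+ 4) (0≤-* (<⇒≤ 0<τ) (0≤-* 0≤w 0≤M)))
              (0≤-+ (0≤-* (0≤+ 4) (0≤-* (0≤-* (<⇒≤ 0<τ) 0≤d) (i≤j⇒0≤j-i Y≤)))
                (0≤-+ (0≤-* (0≤+ 4) (0≤-* (i≤j⇒0≤j-i s≤τd) 0≤Y))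
                  (0≤-* (0≤+ 2) (0≤-* (i≤j⇒0≤j-i ≤s²+2s) 0≤Y))))))))
      (identity M w τ s d X Y Z))
    where
    W = w + d * w
    E = τ * τ * X + (s * s * Y + (- (+ 2 * (τ * s))) * Z)
    <-by : ∀ {x y z} → 0ℤ < z → y ≡ x + z → x < y
    <-by {x} {z = z} 0<z refl = subst (_< x + z) (+-identityʳ x) (+-monoʳ-< x 0<z)
    m<n⇒0<n-m : ∀ {x y} → x < y → 0ℤ < y - x
    m<n⇒0<n-m {x} {y} x<y = subst (_< y - x) (+-inverseʳ x) (+-monoˡ-< (- x) x<y)
    0<2τ : 0ℤ < + 2 * τ
    0<2τ = 0<-* (+<+ {0} {2} (s≤s z≤n)) 0<τ
    0<2W : 0ℤ < + 2 * W
    0<2W = 0<-* (+<+ {0} {2} (s≤s z≤n)) (<-≤-trans (+<+ (s≤s z≤n)) 1≤W)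
    -- Since s² + τ² ≤ τ² (1 + d) and (1 + d) w = W, the hypothesis on E becomes 4 W² E ≤ 2 τ² W.
    -- This is the reason for the precision N = 2 W.
    2WE≤ : + 2 * (W * E) ≤ τ * τ
    2WE≤ = *-cancelˡ-≤ 0<2W (≤-by _
      (0≤-+ (i≤j⇒0≤j-i E≤) (0≤-* (0≤+ 2) (0≤-* (i≤j⇒0≤j-i s²≤) 0≤w)))
      (identity₁ w τ s d E))
      where
      identity₁ : ∀ w τ s d E → (+ 2 * (w + d * w)) * (τ * τ) ≡
        (+ 2 * (w + d * w)) * (+ 2 * ((w + d * w) * E)) +
        ((+ 2 * (s * s + τ * τ) * w -
          ((w + d * w) + (w + d * w)) * ((w + d * w) + (w + d * w)) * E) +
         + 2 * ((τ * τ * d - s * s) * w))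
      identity₁ = solve-∀
    identity : ∀ M w τ s d X Y Z → let W = w + d * w
                                       E = τ * τ * X + (s * s * Y + (- (+ 2 * (τ * s))) * Z) in
      (+ 2 * τ) * (s * (+ 2 * Z)) ≡ (+ 2 * τ) * (τ * (X + d * Y - 1ℤ)) +
      (τ * (τ - + 4 * (W * M)) + ((τ * τ - + 2 * (W * E)) + (+ 2 * ((W - 1ℤ) * E) +
      (+ 4 * (τ * (w * M)) + (+ 4 * ((τ * d) * (w * M - Y)) + (+ 4 * ((τ * d - s) * Y) +
       + 2 * ((s * s + (s + s) - τ * τ * d) * Y)))))))
    identity = solve-∀

  square-lower : ∀ τ s d n A → 0ℤ < τ → 0ℤ ≤ n → s * s ≤ τ * τ * d → τ * n < s * A →
    n * n < d * (A * A)
  square-lower τ s d n A 0<τ 0≤n s²≤ τn<sA =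
    *-cancelˡ-<-nonNeg (τ * τ) {{nonNegative (0≤-sq τ)}} (begin-strict
      (τ * τ) * (n * n)      ≡⟨ regroup τ n ⟩
      (τ * n) * (τ * n)      ≤⟨ *-monoˡ-≤-nonNeg (τ * n) {{nonNegative 0≤τn}} (<⇒≤ τn<sA) ⟩
      (τ * n) * (s * A)      <⟨ *-monoʳ-<-pos (s * A) {{positive (≤-<-trans 0≤τn τn<sA)}} τn<sA ⟩
      (s * A) * (s * A)      ≡⟨ regroup s A ⟨
      (s * s) * (A * A)      ≤⟨ *-monoʳ-≤-nonNeg (A * A) {{nonNegative (0≤-sq A)}} s²≤ ⟩
      (τ * τ * d) * (A * A)  ≡⟨ *-assoc (τ * τ) d (A * A) ⟩
      (τ * τ) * (d * (A * A)) ∎)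
    where
    open ≤-Reasoning
    0≤τn : 0ℤ ≤ τ * n
    0≤τn = 0≤-* (<⇒≤ 0<τ) 0≤n
    regroup : ∀ x y → (x * x) * (y * y) ≡ (x * y) * (x * y)
    regroup = solve-∀

  -- The hypothesis is the nonnegativity of Σ d_S (aᵢ b_S - a b_{S∪i})², which equals
  -- Y (a² - d aᵢ²).
  square-upper : ∀ d X Y Z → 0ℤ < Y →
    let A = + 2 * Z ; a = X + d * Y in
    0ℤ ≤ A * A * X + (a * a * Y + (- (+ 2 * (A * a))) * Z) → d * (A * A) ≤ a * a
  square-upper d X Y Z 0<Y 0≤F = *-cancelˡ-≤ 0<Y (≤-by _ 0≤F (identity d X Y Z))
    where
    identity : ∀ d X Y Z → let A = + 2 * Z ; a = X + d * Y in
      Y * (a * a) ≡ Y * (d * (A * A)) + (A * A * X + (a * a * Y + (- (+ 2 * (A * a))) * Z))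
    identity = solve-∀

  +∣i∣²≡i² : ∀ i → + (∣ i ∣ ℕ.* ∣ i ∣) ≡ i * i
  +∣i∣²≡i² (+ n)    = pos-* n n
  +∣i∣²≡i² -[1+ n ] = refl

  Irrational√ : ℕ → Set
  Irrational√ d = ∀ a m → 1 ℕ.≤ m → d ℕ.* (m ℕ.* m) ≢ a ℕ.* a

  irrational⇒pos : ∀ {d} → Irrational√ d → 1 ℕ.≤ d
  irrational⇒pos {zero}  irr = contradiction refl (irr 0 1 ℕ.≤-refl)
  irrational⇒pos {suc d} irr = s≤s z≤n

  squeeze : ∀ (d s τ : ℕ) (W M w X Y Z E a : ℤ) → Irrational√ d →
    W ≡ w + + d * w → a ≡ X + + d * Y →
    E ≡ + τ * + τ * X + (+ s * + s * Y + (- (+ 2 * (+ τ * + s))) * Z) →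
    (∀ u v → 0ℤ ≤ u * u * X + (v * v * Y + (- (+ 2 * (u * v))) * Z)) →
    1ℤ ≤ W → 0ℤ ≤ M → 0ℤ ≤ w → 1ℤ ≤ Y → 1ℤ ≤ a → 0ℤ ≤ E →
    + 4 * (W * M) < + τ → + s * + s ≤ + τ * + τ * + d →
    + τ * + τ * + d ≤ + s * + s + (+ s + + s) → + s ≤ + τ * + d →
    Y ≤ w * M → (W + W) * (W + W) * E ≤ + 2 * (+ s * + s + + τ * + τ) * w →
    let n = ∣ a - 1ℤ ∣ in
    ∃[ m ] n ℕ.* n ℕ.< d ℕ.* (m ℕ.* m) × d ℕ.* (m ℕ.* m) ℕ.< suc n ℕ.* suc n
  squeeze d s τ W M w X Y Z E a irr W≡ a≡ E≡ 0≤form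
    1≤W 0≤M 0≤w 1≤Y 1≤a 0≤E 4WM<τ s²≤ ≤s²+2s s≤ Y≤ E≤ =
    -- Positivity yields only d m² ≤ (n + 1)²; equality would make √d rational.
    ∣ A ∣ , n²<dm² , ℕ.≤∧≢⇒< dm²≤ (irr (suc n) ∣ A ∣ 1≤m)
    where
    A = + 2 * Z
    n = ∣ a - 1ℤ ∣
    0<τ : 0ℤ < + τ
    0<τ = ≤-<-trans (0≤-* (0≤+ 4) (0≤-* (≤-trans (0≤+ 1) 1≤W) 0≤M)) 4WM<τ
    +n≡ : + n ≡ a - 1ℤ
    +n≡ = 0≤i⇒+∣i∣≡i (i≤j⇒0≤j-i 1≤a)
    lower : + τ * + n < + s * A
    lower = subst (λ t → + τ * t < + s * A) (sym (trans +n≡ (cong (_- 1ℤ) a≡)))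
      (lower-estimate W M w (+ τ) (+ s) (+ d) X Y Z E W≡ E≡ 1≤W 0≤M 0≤w 0<τ
        (0≤+ s) (0≤+ d) (≤-trans (0≤+ 1) 1≤Y) 0≤E 4WM<τ s²≤ ≤s²+2s s≤ Y≤ E≤)
    dA²≡ : + d * (A * A) ≡ + (d ℕ.* (∣ A ∣ ℕ.* ∣ A ∣))
    dA²≡ = trans (cong (+ d *_) (sym (+∣i∣²≡i² A))) (sym (pos-* d (∣ A ∣ ℕ.* ∣ A ∣)))
    n²<dm² : n ℕ.* n ℕ.< d ℕ.* (∣ A ∣ ℕ.* ∣ A ∣)
    n²<dm² = drop‿+<+ (subst₂ _<_ (sym (pos-* n n)) dA²≡
      (square-lower (+ τ) (+ s) (+ d) (+ n) A 0<τ (0≤+ n) s²≤ lower))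
    1≤m : 1 ℕ.≤ ∣ A ∣
    1≤m with ∣ A ∣ | n²<dm²
    ... | zero  | n²<0 = contradiction (subst (n ℕ.* n ℕ.<_) (ℕ.*-zeroʳ d) n²<0) λ()
    ... | suc _ | _    = s≤s z≤n
    cancel : ∀ x → x ≡ 1ℤ + (x - 1ℤ)
    cancel = solve-∀
    a≡1+n : a ≡ + suc n
    a≡1+n = trans (cancel a) (cong (λ t → 1ℤ + t) (sym +n≡))
    a²≡ : a * a ≡ + (suc n ℕ.* suc n)
    a²≡ = trans (cong (λ t → t * t) a≡1+n) (sym (pos-* (suc n) (suc n)))
    dm²≤ : d ℕ.* (∣ A ∣ ℕ.* ∣ A ∣) ℕ.≤ suc n ℕ.* suc n
    dm²≤ = drop‿+≤+ (subst₂ _≤_ dA²≡ (trans (cong (λ t → t * t) (sym a≡)) a²≡)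
      (square-upper (+ d) X Y Z (<-≤-trans (+<+ (s≤s z≤n)) 1≤Y) (0≤form A (X + + d * Y))))

  -- The number n is built from the sum over the whole cube and does not mention i, so the same n
  -- serves every `d i`. Only m depends on i, through the edges of the cube in direction i.
  hypercubeInterval : ∀ {k} (d : Fin (suc k) → ℕ) (b : Vec Bool (suc k) → ℤ) (M : ℤ) i (s τ : ℕ) →
    let W = weighted d (λ _ → 1ℤ)
        n = ∣ weighted d (λ S → b S * b S) - 1ℤ ∣ in
    (∀ i → 1 ℕ.≤ d i) → Irrational√ (d i) →
    0ℤ ≤ M → + 4 * (W * M) < + τ →
    + s * + s ≤ + τ * + τ * + d i → + τ * + τ * + d i ≤ + s * + s + (+ s + + s) →
    + s ≤ + τ * + d i →
    1ℤ ≤ b full * b full → (∀ S → b S * b S ≤ M) →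
    (∀ S → let e = + τ * b (insertAt S i false) - + s * b (insertAt S i true) in
      ((W + W) * (W + W)) * (e * e) ≤ + 2 * (+ s * + s + + τ * + τ)) →
    ∃[ m ] n ℕ.* n ℕ.< d i ℕ.* (m ℕ.* m) × d i ℕ.* (m ℕ.* m) ℕ.< suc n ℕ.* suc n
  hypercubeInterval {k} d b M i s τ 1≤d irr 0≤M 4WM<τ s²≤ ≤s²+2s s≤ 1≤b² b²≤M edge =
    squeeze (d i) s τ W M w X Y Z E a irr
      (weighted-split d i (λ _ → 1ℤ)) (weighted-split d i (λ S → b S * b S))
      (weighted-quadratic d′ (+ τ) (+ s) b₀ b₁) 0≤form
      (weighted-full d 1≤d (λ _ → 0≤+ 1)) 0≤M (weighted-nonNeg d′ (λ _ → 0≤+ 1)) 1≤Y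
      (≤-trans 1≤b² (weighted-full d 1≤d (λ S → 0≤-sq (b S))))
      (weighted-nonNeg d′ (λ S → 0≤-sq (e S)))
      4WM<τ s²≤ ≤s²+2s s≤ Y≤ E≤
    where
    d′ = removeAt d i
    W = weighted d (λ _ → 1ℤ)
    a = weighted d (λ S → b S * b S)
    b₀ b₁ e : Vec Bool k → ℤ
    b₀ S = b (insertAt S i false)
    b₁ S = b (insertAt S i true)
    e S = + τ * b₀ S - + s * b₁ S
    w = weighted d′ (λ _ → 1ℤ)
    X = weighted d′ (λ S → b₀ S * b₀ S)
    Y = weighted d′ (λ S → b₁ S * b₁ S)
    Z = weighted d′ (λ S → b₀ S * b₁ S)
    E = weighted d′ (λ S → e S * e S)
    1≤Y : 1ℤ ≤ Y
    -- The full set contains i, so its numerator is among those summed in Y.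
    1≤Y = ≤-trans (subst (λ S → 1ℤ ≤ b S * b S) (sym (insertAt-full i)) 1≤b²)
      (weighted-full d′ (λ j → 1≤d (punchIn i j)) (λ S → 0≤-sq (b₁ S)))
    0≤form : ∀ u v → 0ℤ ≤ u * u * X + (v * v * Y + (- (+ 2 * (u * v))) * Z)
    0≤form u v = subst (0ℤ ≤_) (weighted-quadratic d′ u v b₀ b₁)
      (weighted-nonNeg d′ (λ S → 0≤-sq (u * b₀ S - v * b₁ S)))
    C = (W + W) * (W + W)
    D = + 2 * (+ s * + s + + τ * + τ)
    E≤ : C * E ≤ D * w
    E≤ = subst₂ _≤_ (weighted-* d′ C (λ S → e S * e S)) (weighted-* d′ D (λ _ → 1ℤ))
      (weighted-mono d′ (λ S → ≤-trans (edge S) (≤-reflexive (sym (*-identityʳ D)))))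
    Y≤ : Y ≤ w * M
    Y≤ = subst (Y ≤_) (trans (weighted-* d′ M (λ _ → 1ℤ)) (*-comm M w))
      (weighted-mono d′ (λ S →
        ≤-trans (b²≤M (insertAt S i true)) (≤-reflexive (sym (*-identityʳ M)))))

  -- Choice of the constants

  pos-*-* : ∀ x y z → + (x ℕ.* y ℕ.* z) ≡ + x * + y * + z
  pos-*-* x y z = trans (pos-* (x ℕ.* y) z) (cong (_* + z) (pos-* x y))

  -- `root` is the integer part of τ√d. The field `small` is the crude consequence √d ≤ d for d ≥ 1,
  -- enough to bound the rounding error linearly in τ.
  record ScaledRoot (τ d : ℕ) : Set where
    field
      root  : ℕ
      lower : + root * + root ≤ + τ * + τ * + d
      upper : + τ * + τ * + d ≤ + root * + root + (+ root + + root)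
      small : + root ≤ + τ * + d

  scaledRoot : ∀ τ d → 1 ℕ.≤ d → ScaledRoot τ d
  scaledRoot τ d 1≤d with isqrt (τ ℕ.* τ ℕ.* d)
  ... | s , s²≤ , ≤s²+2s = record
    { root  = s
    ; lower = subst₂ _≤_ (pos-* s s) (pos-*-* τ τ d) (+≤+ s²≤)
    ; upper = subst₂ _≤_ (pos-*-* τ τ d)
        (trans (pos-+ (s ℕ.* s) (s ℕ.+ s)) (cong₂ _+_ (pos-* s s) (pos-+ s s))) (+≤+ ≤s²+2s)
    ; small = subst (+ s ≤_) (pos-* τ d) (+≤+ (ℕ.≮⇒≥ λ τd<s → ℕ.<⇒≱ (ℕ.*-mono-< τd<s τd<s)
        (ℕ.≤-trans s²≤ τ²d≤)))
    }
    where
    τ²d≤ : τ ℕ.* τ ℕ.* d ℕ.≤ (τ ℕ.* d) ℕ.* (τ ℕ.* d)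
    τ²d≤ = subst (ℕ._≤ (τ ℕ.* d) ℕ.* (τ ℕ.* d)) (sym (ℕ.*-assoc τ τ d))
      (ℕ.*-monoˡ-≤ (τ ℕ.* d) (ℕ.m≤m*n τ d {{ℕ.>-nonZero 1≤d}}))

  -- For the full set the approximated product is 1, so b is within 1 / N ≤ 1/2 of the integer q ≥ 1
  -- and cannot vanish.
  square-pos : ∀ N q b T → 2 ℕ.≤ N → 1 ℕ.≤ q → 1 ℕ.≤ T →
    (+ N * (+ q * + T - b * + T)) * (+ N * (+ q * + T - b * + T)) ≤ + T * + T → 1ℤ ≤ b * b
  square-pos N q -[1+ n ] T 2≤N 1≤q 1≤T close = +≤+ (s≤s z≤n)
  square-pos N q +[1+ n ] T 2≤N 1≤q 1≤T close = +≤+ (s≤s z≤n)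
  square-pos N q +0 T 2≤N 1≤q 1≤T close =
    contradiction (drop‿+≤+ (subst₂ _≤_ square≡ (sym (pos-* T T)) close))
      (ℕ.<⇒≱ (ℕ.*-mono-< T<NqT T<NqT))
    where
    x = N ℕ.* (q ℕ.* T)
    T<NqT : T ℕ.< x
    T<NqT = begin-strict
      T                   <⟨ ℕ.m<m+n T 1≤T ⟩
      T ℕ.+ T             ≡⟨ cong (T ℕ.+_) (ℕ.+-identityʳ T) ⟨
      2 ℕ.* T             ≤⟨ ℕ.*-mono-≤ 2≤N (ℕ.m≤n*m T q {{ℕ.>-nonZero 1≤q}}) ⟩
      N ℕ.* (q ℕ.* T)     ∎
      where open ℕ.≤-Reasoning
    term≡ : + N * (+ q * + T - 0ℤ * + T) ≡ + x
    term≡ = trans (cong (+ N *_) (trans (+-identityʳ (+ q * + T)) (sym (pos-* q T))))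
      (sym (pos-* N (q ℕ.* T)))
    square≡ : (+ N * (+ q * + T - 0ℤ * + T)) * (+ N * (+ q * + T - 0ℤ * + T)) ≡ + (x ℕ.* x)
    square≡ = trans (cong (λ t → t * t) term≡) (sym (pos-* x x))

  approximationInterval : ∀ {k} (d : Fin (suc k) → ℕ) (W N Q τ T q : ℕ) (M : ℤ)
    (roots : ∀ i → ScaledRoot τ (d i)) (b : Vec Bool (suc k) → ℤ) →
    (∀ i → Irrational√ (d i)) → weighted d (λ _ → 1ℤ) ≡ + W → N ≡ W ℕ.+ W → T ≡ τ ℕ.^ suc k →
    M ≡ + 2 * (+ Q * + Q * + W) + + 2 → 2 ℕ.≤ N → 1 ℕ.≤ T → 1 ℕ.≤ q → q ℕ.≤ Q →
    0ℤ ≤ M → + 4 * (+ W * M) < + τ →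
    Approximates N T (rootProduct (λ i → ScaledRoot.root (roots i)) τ) q b →
    ∃[ n ] 1 ℕ.≤ n × (∀ i → ∃[ m ]
      n ℕ.* n ℕ.< d i ℕ.* (m ℕ.* m) × d i ℕ.* (m ℕ.* m) ℕ.< suc n ℕ.* suc n)
  approximationInterval {k} d W N Q τ T q M roots b irr
    W≡ N≡ T≡ M≡ 2≤N 1≤T 1≤q q≤Q 0≤M 4WM<τ close =
    n , 1≤n n inside , inside
    where
    open ScaledRoot
    s : Fin (suc k) → ℕ
    s i = root (roots i)
    p : Vec Bool (suc k) → ℤ
    p = rootProduct s τ
    1≤d : ∀ i → 1 ℕ.≤ d i
    1≤d i = irrational⇒pos (irr i)
    n = ∣ weighted d (λ S → b S * b S) - 1ℤ ∣
    0<T : 0ℤ < + T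
    0<T = +<+ 1≤T
    p-full : p full ≡ + T
    p-full = trans (rootProduct-full s τ) (cong +_ (sym T≡))
    1≤b² : 1ℤ ≤ b full * b full
    1≤b² = square-pos N q (b full) T 2≤N 1≤q 1≤T
      (subst (λ t → (+ N * (+ q * t - b full * + T)) * (+ N * (+ q * t - b full * + T)) ≤ + T * + T)
        p-full (close full))
    p²≤ : ∀ S → p S * p S ≤ + T * + T * + W
    p²≤ S = subst₂ (λ t w → p S * p S ≤ + t * + t * w) (sym T≡) W≡
      (rootProduct-bound d s τ (λ i → lower (roots i)) S)
    b²≤M : ∀ S → b S * b S ≤ M
    b²≤M S = subst (b S * b S ≤_) (sym M≡)
      (numerator-bound (+ N) (+ T) (+ q) (+ Q) (p S) (b S) (+ W) 0<T
        (+≤+ (ℕ.<⇒≤ 2≤N)) (0≤+ q) (+≤+ q≤Q) (p²≤ S) (close S))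
    N≡W+W : + N ≡ weighted d (λ _ → 1ℤ) + weighted d (λ _ → 1ℤ)
    N≡W+W = trans (trans (cong +_ N≡) (pos-+ W W)) (cong (λ t → t + t) (sym W≡))
    inside : ∀ i → ∃[ m ] n ℕ.* n ℕ.< d i ℕ.* (m ℕ.* m) × d i ℕ.* (m ℕ.* m) ℕ.< suc n ℕ.* suc n
    inside i = hypercubeInterval d b M i (s i) τ 1≤d (irr i) 0≤M
      (subst (λ t → + 4 * (t * M) < + τ) (sym W≡) 4WM<τ)
      (lower (roots i)) (upper (roots i)) (small (roots i)) 1≤b² b²≤M edge
      where
      edge : ∀ S → let e = + τ * b (insertAt S i false) - + s i * b (insertAt S i true)
                       V = weighted d (λ _ → 1ℤ) + weighted d (λ _ → 1ℤ) in
        (V * V) * (e * e) ≤ + 2 * (+ s i * + s i + + τ * + τ)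
      edge S = subst (λ t → (t * t) * (e * e) ≤ + 2 * (+ s i * + s i + + τ * + τ)) N≡W+W
        (edge-bound (+ N) (+ T) (+ τ) (+ s i) (+ q) (p S₀) (p S₁) (b S₀) (b S₁)
          0<T (rootProduct-insertAt s τ i S) (close S₀) (close S₁))
        where
        S₀ = insertAt S i false
        S₁ = insertAt S i true
        e = + τ * b S₀ - + s i * b S₁
    -- For n = 0 the integer d m² would lie strictly between 0 and 1; the index `zero` supplies such
    -- an m.
    1≤n : ∀ n → (∀ i → ∃[ m ]
      n ℕ.* n ℕ.< d i ℕ.* (m ℕ.* m) × d i ℕ.* (m ℕ.* m) ℕ.< suc n ℕ.* suc n) → 1 ℕ.≤ n
    1≤n (suc _) _ = s≤s z≤n
    1≤n zero inside with inside zero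
    ... | m , 0<dm² , dm²<1 = contradiction dm²<1 (ℕ.≤⇒≯ 0<dm²)

  -- The constants are chosen in an order that avoids circularity: W from d, N = 2 W, then Q from N,
  -- the bound M on the squared numerators from Q, and τ from M. Only then are the roots rounded and
  -- q ≤ Q and b obtained.
  commonInterval : ∀ {k} (d : Fin (suc k) → ℕ) → (∀ i → Irrational√ (d i)) →
    ∃[ n ] 1 ℕ.≤ n × (∀ i → ∃[ m ]
      n ℕ.* n ℕ.< d i ℕ.* (m ℕ.* m) × d i ℕ.* (m ℕ.* m) ℕ.< suc n ℕ.* suc n)
  commonInterval {k} d irr =
    let Q , approx = dirichlet (suc k) N {{N≢0}}
        q , (1≤q , q≤Q) , b , close = approx (τ Q ℕ.^ suc k) {{T≢0 Q}}
          (rootProduct (λ i → ScaledRoot.root (roots Q i)) (τ Q))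
    in approximationInterval d W N Q (τ Q) (τ Q ℕ.^ suc k) q (M Q) (roots Q) b irr
         (sym +W≡) refl refl refl 2≤N (ℕ.>-nonZero⁻¹ _ {{T≢0 Q}}) 1≤q q≤Q (0≤M Q) (4WM<τ Q) close
    where
    1≤d : ∀ i → 1 ℕ.≤ d i
    1≤d i = irrational⇒pos (irr i)
    1≤weight : 1ℤ ≤ weighted d (λ _ → 1ℤ)
    1≤weight = weighted-full d 1≤d (λ _ → 0≤+ 1)
    W = ∣ weighted d (λ _ → 1ℤ) ∣
    +W≡ : + W ≡ weighted d (λ _ → 1ℤ)
    +W≡ = 0≤i⇒+∣i∣≡i (≤-trans (0≤+ 1) 1≤weight)
    1≤W : 1 ℕ.≤ W
    1≤W = drop‿+≤+ (subst (1ℤ ≤_) (sym +W≡) 1≤weight)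
    N = W ℕ.+ W
    2≤N : 2 ℕ.≤ N
    2≤N = ℕ.+-mono-≤ 1≤W 1≤W
    N≢0 : ℕ.NonZero N
    N≢0 = ℕ.>-nonZero (ℕ.<⇒≤ 2≤N)
    M : ℕ → ℤ
    M Q = + 2 * (+ Q * + Q * + W) + + 2
    0≤M : ∀ Q → 0ℤ ≤ M Q
    0≤M Q = 0≤-+ (0≤-* (0≤+ 2) (0≤-* (0≤-sq (+ Q)) (0≤+ W))) (0≤+ 2)
    τ : ℕ → ℕ
    -- The least τ above 4 W M, the bound under which rounding the roots costs less than 1/2.
    τ Q = suc ∣ + 4 * (+ W * M Q) ∣
    T≢0 : ∀ Q → ℕ.NonZero (τ Q ℕ.^ suc k)
    T≢0 Q = ℕ.m^n≢0 (τ Q) (suc k)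
    4WM<τ : ∀ Q → + 4 * (+ W * M Q) < + τ Q
    4WM<τ Q = subst (_< + τ Q) (0≤i⇒+∣i∣≡i (0≤-* (0≤+ 4) (0≤-* (0≤+ W) (0≤M Q)))) (+<+ (ℕ.n<1+n _))
    roots : ∀ Q i → ScaledRoot (τ Q) (d i)
    roots Q i = scaledRoot (τ Q) (d i) (1≤d i)

open import Defs
open import Data.Fin.Base using (Fin; zero; suc)
open import Data.Integer.Base as ℤ using (ℤ; +_; -[1+_]; 1ℤ; -1ℤ)
import Data.Integer.Properties as ℤ
open import Data.Rational.Base as ℚ using (ℚ; 0ℚ; 1ℚ; ½; ↥_; ↧_)
import Data.Rational.Properties as ℚ
open import Data.Rational.Solver using (module +-*-Solver)
import Data.Rational.Unnormalised.Base as ℚᵘ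
import Data.Rational.Unnormalised.Properties as ℚᵘ
open import Data.Sum.Base using (_⊎_; inj₁; inj₂)
open import Level using (Level)
open import Relation.Binary.Bundles using (Setoid)
import Relation.Binary.Reasoning.Setoid as SetoidReasoning
open import Relation.Unary using (Pred; _∈_; _⊆_; _≐_)

open Hypercube using (≤-by; Irrational√; commonInterval)

-- Null sequences and equality of reals

Eventually : (ℕ → Set) → Set
Eventually P = ∃[ N ] (∀ n → N ℕ.≤ n → P n)

map-eventually : ∀ {P Q : ℕ → Set} → (∀ n → P n → Q n) → Eventually P → Eventually Q
map-eventually f (N , p) = N , λ n N≤n → f n (p n N≤n)

zip-eventually : ∀ {P Q R : ℕ → Set} → (∀ n → P n → Q n → R n) →
  Eventually P → Eventually Q → Eventually R
zip-eventually f (M , p) (N , q) = M ℕ.⊔ N , λ n M⊔N≤n →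
  f n (p n (ℕ.≤-trans (ℕ.m≤m⊔n M N) M⊔N≤n)) (q n (ℕ.≤-trans (ℕ.m≤n⊔m M N) M⊔N≤n))

eventually⇒∃ : ∀ {P : ℕ → Set} → Eventually P → ∃[ n ] P n
eventually⇒∃ (N , p) = N , p N ℕ.≤-refl

-- `x ≃ y` unfolds to `Null` of the termwise difference, so facts about null sequences apply
-- directly to equalities of reals.
Null : (ℕ → ℚ) → Set
Null u = ∀ ε → 0ℚ ℚ.< ε → Eventually (λ n → ℚ.∣ u n ∣ ℚ.< ε)

<⇒≱ℚ : ∀ {p q} → p ℚ.< q → ¬ q ℚ.≤ p
<⇒≱ℚ p<q q≤p = ℚ.<-irrefl refl (ℚ.<-≤-trans p<q q≤p)

*-monoˡ-≤ : ∀ {p q r} → 0ℚ ℚ.≤ r → p ℚ.≤ q → r ℚ.* p ℚ.≤ r ℚ.* q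
*-monoˡ-≤ {r = r} 0≤r = ℚ.*-monoˡ-≤-nonNeg r {{ℚ.nonNegative 0≤r}}

0≤-*ℚ : ∀ {p q} → 0ℚ ℚ.≤ p → 0ℚ ℚ.≤ q → 0ℚ ℚ.≤ p ℚ.* q
0≤-*ℚ {p} {q} 0≤p 0≤q = subst (ℚ._≤ p ℚ.* q) (ℚ.*-zeroʳ p) (*-monoˡ-≤ 0≤p 0≤q)

0<-*ℚ : ∀ {p q} → 0ℚ ℚ.< p → 0ℚ ℚ.< q → 0ℚ ℚ.< p ℚ.* q
0<-*ℚ {p} {q} 0<p 0<q =
  subst (ℚ._< p ℚ.* q) (ℚ.*-zeroʳ p) (ℚ.*-monoʳ-<-pos p {{ℚ.positive 0<p}} 0<q)

*-mono-≤ : ∀ {p q r s} → 0ℚ ℚ.≤ p → 0ℚ ℚ.≤ r → p ℚ.≤ q → r ℚ.≤ s → p ℚ.* r ℚ.≤ q ℚ.* s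
*-mono-≤ {p} {q} {r} {s} 0≤p 0≤r p≤q r≤s = ℚ.≤-trans
  (ℚ.*-monoʳ-≤-nonNeg r {{ℚ.nonNegative 0≤r}} p≤q) (*-monoˡ-≤ (ℚ.≤-trans 0≤p p≤q) r≤s)

reciprocal : ∀ {p} → p ≢ 0ℚ → ∃[ r ] p ℚ.* r ≡ 1ℚ
reciprocal {p} p≢0 = (ℚ.1/ p) {{nz}} , ℚ.*-inverseʳ p {{nz}}
  where nz = ℚ.≢-nonZero p≢0

reciprocal-pos : ∀ {p} → 0ℚ ℚ.< p → ∃[ r ] 0ℚ ℚ.< r × p ℚ.* r ≡ 1ℚ
reciprocal-pos {p} 0<p = (ℚ.1/ p) {{nz}} ,
  ℚ.positive⁻¹ _ {{ℚ.1/pos⇒pos p {{ℚ.positive 0<p}}}} , ℚ.*-inverseʳ p {{nz}}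
  where nz = ℚ.pos⇒nonZero p {{ℚ.positive 0<p}}

null-cong : ∀ {u v} → (∀ n → u n ≡ v n) → Null u → Null v
null-cong u≡v null ε ε>0 =
  map-eventually (λ n → subst (λ t → ℚ.∣ t ∣ ℚ.< ε) (u≡v n)) (null ε ε>0)

null-dominated : ∀ {u v} c → 0ℚ ℚ.< c →
  Eventually (λ n → ℚ.∣ u n ∣ ℚ.≤ c ℚ.* ℚ.∣ v n ∣) → Null v → Null u
null-dominated {u} {v} c c>0 dominated null ε ε>0 =
  let r , r>0 , cr≡1 = reciprocal-pos c>0
      crε≡ε = trans (sym (ℚ.*-assoc c r ε)) (trans (cong (ℚ._* ε) cr≡1) (ℚ.*-identityˡ ε))
  in zip-eventually
    (λ n ∣u∣≤ ∣v∣< → ℚ.≤-<-trans ∣u∣≤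
      (subst (c ℚ.* ℚ.∣ v n ∣ ℚ.<_) crε≡ε (ℚ.*-monoʳ-<-pos c {{ℚ.positive c>0}} ∣v∣<)))
    dominated (null (r ℚ.* ε) (0<-*ℚ r>0 ε>0))

½*ε>0 : ∀ {ε} → 0ℚ ℚ.< ε → 0ℚ ℚ.< ½ ℚ.* ε
½*ε>0 = 0<-*ℚ (ℚ.positive⁻¹ ½)

½ε+½ε : ∀ ε → ½ ℚ.* ε ℚ.+ ½ ℚ.* ε ≡ ε
½ε+½ε ε = trans (sym (ℚ.*-distribʳ-+ ε ½ ½)) (ℚ.*-identityˡ ε)

null-+ : ∀ {u v} → Null u → Null v → Null (λ n → u n ℚ.+ v n)
null-+ {u} {v} nu nv ε ε>0 = zip-eventually
  (λ n ∣u∣< ∣v∣< → ℚ.≤-<-trans (ℚ.∣p+q∣≤∣p∣+∣q∣ (u n) (v n))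
    (subst (ℚ.∣ u n ∣ ℚ.+ ℚ.∣ v n ∣ ℚ.<_) (½ε+½ε ε) (ℚ.+-mono-< ∣u∣< ∣v∣<)))
  (nu (½ ℚ.* ε) (½*ε>0 ε>0)) (nv (½ ℚ.* ε) (½*ε>0 ε>0))

null-square : ∀ {u} → Null (λ n → u n ℚ.* u n) → Null u
null-square {u} null ε ε>0 = map-eventually
  (λ n ∣u²∣< → ℚ.≰⇒> λ ε≤∣u∣ → <⇒≱ℚ
    (subst (ℚ._< ε ℚ.* ε) (ℚ.∣p*q∣≡∣p∣*∣q∣ (u n) (u n)) ∣u²∣<)
    (*-mono-≤ (ℚ.<⇒≤ ε>0) (ℚ.<⇒≤ ε>0) ε≤∣u∣ ε≤∣u∣))
  (null (ε ℚ.* ε) (0<-*ℚ ε>0 ε>0))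

bounded : ∀ x → ∃[ B ] 0ℚ ℚ.< B × Eventually (λ n → ℚ.∣ seq x n ∣ ℚ.≤ B)
bounded x with cauchy x 1ℚ (ℚ.positive⁻¹ 1ℚ)
... | N , close = 1ℚ ℚ.+ ℚ.∣ seq x N ∣ ,
  ℚ.+-mono-<-≤ (ℚ.positive⁻¹ 1ℚ) (ℚ.0≤∣p∣ (seq x N)) ,
  N , λ n N≤n → begin
    ℚ.∣ seq x n ∣
      ≡⟨ cong ℚ.∣_∣ (split (seq x n) (seq x N)) ⟩
    ℚ.∣ (seq x n ℚ.- seq x N) ℚ.+ seq x N ∣
      ≤⟨ ℚ.∣p+q∣≤∣p∣+∣q∣ (seq x n ℚ.- seq x N) (seq x N) ⟩
    ℚ.∣ seq x n ℚ.- seq x N ∣ ℚ.+ ℚ.∣ seq x N ∣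
      ≤⟨ ℚ.+-monoˡ-≤ ℚ.∣ seq x N ∣ (ℚ.<⇒≤ (close n N N≤n ℕ.≤-refl)) ⟩
    1ℚ ℚ.+ ℚ.∣ seq x N ∣ ∎
  where
  open ℚ.≤-Reasoning
  split : ∀ a b → a ≡ (a ℚ.- b) ℚ.+ b
  split = solve 2 (λ a b → a := (a :- b) :+ b) refl
    where open +-*-Solver

null-* : ∀ x {v} → Null v → Null (λ n → seq x n ℚ.* v n)
null-* x {v} null =
  let B , B>0 , x≤B = bounded x in
  null-dominated B B>0
    (map-eventually (λ n ∣x∣≤B → subst (ℚ._≤ B ℚ.* ℚ.∣ v n ∣)
      (sym (ℚ.∣p*q∣≡∣p∣*∣q∣ (seq x n) (v n)))
      (ℚ.*-monoʳ-≤-nonNeg ℚ.∣ v n ∣ {{ℚ.nonNegative (ℚ.0≤∣p∣ (v n))}} ∣x∣≤B)) x≤B)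
    null

≗⇒≃ : ∀ {x y} → (∀ n → seq x n ≡ seq y n) → x ≃ y
≗⇒≃ {x} {y} x≡y ε ε>0 = 0 , λ n _ → subst (λ t → ℚ.∣ t ∣ ℚ.< ε)
  (sym (trans (cong (ℚ._- seq y n) (x≡y n)) (ℚ.+-inverseʳ (seq y n)))) ε>0

close-sym : ∀ p q {ε} → ℚ.∣ p ℚ.- q ∣ ℚ.< ε → ℚ.∣ q ℚ.- p ∣ ℚ.< ε
close-sym p q {ε} = subst (ℚ._< ε)
  (trans (sym (ℚ.∣-p∣≡∣p∣ (p ℚ.- q))) (cong ℚ.∣_∣ (flip p q)))
  where
  flip : ∀ a b → ℚ.- (a ℚ.- b) ≡ b ℚ.- a
  flip = solve 2 (λ a b → :- (a :- b) := b :- a) refl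
    where open +-*-Solver

≃-sym : ∀ {x y} → x ≃ y → y ≃ x
≃-sym {x} {y} x≃y ε ε>0 =
  map-eventually (λ n → close-sym (seq x n) (seq y n)) (x≃y ε ε>0)

≃-trans : ∀ {x y z} → x ≃ y → y ≃ z → x ≃ z
≃-trans {x} {y} {z} x≃y y≃z =
  null-cong (λ n → telescope (seq x n) (seq y n) (seq z n)) (null-+ x≃y y≃z)
  where
  telescope : ∀ a b c → (a ℚ.- b) ℚ.+ (b ℚ.- c) ≡ a ℚ.- c
  telescope = solve 3 (λ a b c → (a :- b) :+ (b :- c) := a :- c) refl
    where open +-*-Solver

+-cong : ∀ {x x′ y y′} → x ≃ x′ → y ≃ y′ → x + y ≃ x′ + y′
+-cong {x} {x′} {y} {y′} x≃x′ y≃y′ =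
  null-cong (λ n → rearrange (seq x n) (seq x′ n) (seq y n) (seq y′ n)) (null-+ x≃x′ y≃y′)
  where
  rearrange : ∀ a a′ b b′ → (a ℚ.- a′) ℚ.+ (b ℚ.- b′) ≡ (a ℚ.+ b) ℚ.- (a′ ℚ.+ b′)
  rearrange = solve 4 (λ a a′ b b′ → (a :- a′) :+ (b :- b′) := (a :+ b) :- (a′ :+ b′)) refl
    where open +-*-Solver

*-cong : ∀ {x x′ y y′} → x ≃ x′ → y ≃ y′ → x * y ≃ x′ * y′
*-cong {x} {x′} {y} {y′} x≃x′ y≃y′ =
  null-cong (λ n → rearrange (seq x n) (seq x′ n) (seq y n) (seq y′ n))
    (null-+ (null-* x y≃y′) (null-* y′ x≃x′))
  where
  rearrange : ∀ a a′ b b′ →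
    a ℚ.* (b ℚ.- b′) ℚ.+ b′ ℚ.* (a ℚ.- a′) ≡ a ℚ.* b ℚ.- a′ ℚ.* b′
  rearrange = solve 4 (λ a a′ b b′ →
    a :* (b :- b′) :+ b′ :* (a :- a′) := a :* b :- a′ :* b′) refl
    where open +-*-Solver

fromℚ-injective : ∀ {p q} → fromℚ p ≃ fromℚ q → p ≡ q
fromℚ-injective {p} {q} p≃q with p ℚ.≟ q
... | yes p≡q = p≡q
... | no  p≢q =
  let _ , ∣p-q∣< = eventually⇒∃ (p≃q ℚ.∣ p ℚ.- q ∣ ∣p-q∣>0) in
  contradiction ∣p-q∣< (ℚ.<-irrefl refl)
  where
  restore : ∀ a b → a ≡ (a ℚ.- b) ℚ.+ b
  restore = solve 2 (λ a b → a := (a :- b) :+ b) refl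
    where open +-*-Solver
  ∣p-q∣>0 : 0ℚ ℚ.< ℚ.∣ p ℚ.- q ∣
  ∣p-q∣>0 = ℚ.≰⇒> λ ∣p-q∣≤0 → p≢q (trans (restore p q)
    (trans (cong (ℚ._+ q) (ℚ.∣p∣≡0⇒p≡0 _ (ℚ.≤-antisym ∣p-q∣≤0 (ℚ.0≤∣p∣ _)))) (ℚ.+-identityˡ q)))

-- The integers inside the rationals

ι : ℤ → ℚ
ι z = z ℚ./ 1

-- Division by 1 in ℚ goes through normalisation; the laws of `ι` are therefore transported from
-- unnormalised fractions, where they reduce to integer identities.
toℚᵘ-ι : ∀ z → ℚ.toℚᵘ (ι z) ℚᵘ.≃ (z ℚᵘ./ 1)
toℚᵘ-ι z = ℚ.toℚᵘ-fromℚᵘ (z ℚᵘ./ 1)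

ι-+ : ∀ x y → ι (x ℤ.+ y) ≡ ι x ℚ.+ ι y
ι-+ x y = ℚ.toℚᵘ-injective (begin
  ℚ.toℚᵘ (ι (x ℤ.+ y))               ≈⟨ toℚᵘ-ι (x ℤ.+ y) ⟩
  (x ℤ.+ y) ℚᵘ./ 1                   ≈⟨ ℚᵘ.*≡* (cong (ℤ._* + 1)
                                         (sym (cong₂ ℤ._+_ (ℤ.*-identityʳ x) (ℤ.*-identityʳ y)))) ⟩
  (x ℚᵘ./ 1) ℚᵘ.+ (y ℚᵘ./ 1)         ≈⟨ ℚᵘ.+-cong (toℚᵘ-ι x) (toℚᵘ-ι y) ⟨
  ℚ.toℚᵘ (ι x) ℚᵘ.+ ℚ.toℚᵘ (ι y)     ≈⟨ ℚ.toℚᵘ-homo-+ (ι x) (ι y) ⟨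
  ℚ.toℚᵘ (ι x ℚ.+ ι y)               ∎)
  where open ℚᵘ.≃-Reasoning

ι-* : ∀ x y → ι (x ℤ.* y) ≡ ι x ℚ.* ι y
ι-* x y = ℚ.toℚᵘ-injective (begin
  ℚ.toℚᵘ (ι (x ℤ.* y))               ≈⟨ toℚᵘ-ι (x ℤ.* y) ⟩
  (x ℤ.* y) ℚᵘ./ 1                   ≈⟨ ℚᵘ.*≡* refl ⟩
  (x ℚᵘ./ 1) ℚᵘ.* (y ℚᵘ./ 1)         ≈⟨ ℚᵘ.*-cong (toℚᵘ-ι x) (toℚᵘ-ι y) ⟨
  ℚ.toℚᵘ (ι x) ℚᵘ.* ℚ.toℚᵘ (ι y)     ≈⟨ ℚ.toℚᵘ-homo-* (ι x) (ι y) ⟨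
  ℚ.toℚᵘ (ι x ℚ.* ι y)               ∎)
  where open ℚᵘ.≃-Reasoning

ι-neg : ∀ x → ι (ℤ.- x) ≡ ℚ.- ι x
ι-neg x = ℚ.toℚᵘ-injective (begin
  ℚ.toℚᵘ (ι (ℤ.- x))      ≈⟨ toℚᵘ-ι (ℤ.- x) ⟩
  (ℤ.- x) ℚᵘ./ 1          ≈⟨ ℚᵘ.*≡* refl ⟩
  ℚᵘ.- (x ℚᵘ./ 1)         ≈⟨ ℚᵘ.-‿cong (toℚᵘ-ι x) ⟨
  ℚᵘ.- ℚ.toℚᵘ (ι x)       ≈⟨ ℚ.toℚᵘ-homo‿- (ι x) ⟨
  ℚ.toℚᵘ (ℚ.- ι x)        ∎)
  where open ℚᵘ.≃-Reasoning

ι-mono-≤ : ∀ {x y} → x ℤ.≤ y → ι x ℚ.≤ ι y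
ι-mono-≤ {x} {y} x≤y = ℚ.toℚᵘ-cancel-≤ (begin
  ℚ.toℚᵘ (ι x)  ≃⟨ toℚᵘ-ι x ⟩
  x ℚᵘ./ 1      ≤⟨ ℚᵘ.*≤* (ℤ.*-monoʳ-≤-nonNeg (+ 1) x≤y) ⟩
  y ℚᵘ./ 1      ≃⟨ toℚᵘ-ι y ⟨
  ℚ.toℚᵘ (ι y)  ∎)
  where open ℚᵘ.≤-Reasoning

ι-↥ : ∀ p → p ℚ.* ι (↧ p) ≡ ι (↥ p)
ι-↥ p = ℚ.toℚᵘ-injective (begin
  ℚ.toℚᵘ (p ℚ.* ι (↧ p))             ≈⟨ ℚ.toℚᵘ-homo-* p (ι (↧ p)) ⟩
  ℚ.toℚᵘ p ℚᵘ.* ℚ.toℚᵘ (ι (↧ p))     ≈⟨ ℚᵘ.*-congˡ {ℚ.toℚᵘ p} (toℚᵘ-ι (↧ p)) ⟩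
  ℚ.toℚᵘ p ℚᵘ.* (↧ p ℚᵘ./ 1)         ≈⟨ cancel p ⟩
  ↥ p ℚᵘ./ 1                         ≈⟨ toℚᵘ-ι (↥ p) ⟨
  ℚ.toℚᵘ (ι (↥ p))                   ∎)
  where
  open ℚᵘ.≃-Reasoning
  cancel : ∀ p → ℚ.toℚᵘ p ℚᵘ.* (↧ p ℚᵘ./ 1) ℚᵘ.≃ (↥ p ℚᵘ./ 1)
  cancel p@record{} = ℚᵘ.*≡* (ℤ.*-assoc (↥ p) (↧ p) (+ 1))

ι-pos : ∀ n → 1 ℕ.≤ n → 0ℚ ℚ.< ι (+ n)
ι-pos n 1≤n = ℚ.<-≤-trans (ℚ.positive⁻¹ 1ℚ) (ι-mono-≤ {+ 1} (ℤ.+≤+ 1≤n))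

ι≢0 : ∀ {z} → z ≢ ℤ.0ℤ → ι z ≢ 0ℚ
ι≢0 {z} z≢0 ιz≡0 = z≢0 (trans (sym (ℤ.*-identityʳ z))
  (trans (ℚᵘ.drop-*≡* (ℚᵘ.≃-trans (ℚᵘ.≃-sym (toℚᵘ-ι z)) (ℚ.toℚᵘ-cong ιz≡0)))
    (ℤ.*-zeroˡ (+ 1))))

infix 4 _≈_

-- x ≃ y computes to a Π-type, from which Agda cannot recover x and y.
record _≈_ (x y : ℝ) : Set where
  constructor wrap
  field unwrap : x ≃ y

open _≈_

ℝ-setoid : Setoid _ _
ℝ-setoid = record
  { Carrier = ℝ
  ; _≈_ = _≈_
  ; isEquivalence = record
    { refl  = λ {x} → wrap (≗⇒≃ {x} {x} (λ _ → refl))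
    ; sym   = λ {x} {y} x≈y → wrap (≃-sym {x} {y} (unwrap x≈y))
    ; trans = λ {x} {y} {z} x≈y y≈z → wrap (≃-trans {x} {y} {z} (unwrap x≈y) (unwrap y≈z))
    }
  }

open Setoid ℝ-setoid using () renaming (refl to ≈-refl; sym to ≈-sym; trans to ≈-trans)
module ≈-Reasoning = SetoidReasoning ℝ-setoid

pointwise : ∀ {x y} → (∀ n → seq x n ≡ seq y n) → x ≈ y
pointwise {x} {y} x≡y = wrap (≗⇒≃ {x} {y} x≡y)

≈-+ : ∀ {x x′ y y′} → x ≈ x′ → y ≈ y′ → x + y ≈ x′ + y′
≈-+ {x} {x′} {y} {y′} x≈ y≈ = wrap (+-cong {x} {x′} {y} {y′} (unwrap x≈) (unwrap y≈))

≈-* : ∀ {x x′ y y′} → x ≈ x′ → y ≈ y′ → x * y ≈ x′ * y′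
≈-* {x} {x′} {y} {y′} x≈ y≈ = wrap (*-cong {x} {x′} {y} {y′} (unwrap x≈) (unwrap y≈))

fromℚ-cong : ∀ {p q} → p ≡ q → fromℚ p ≈ fromℚ q
fromℚ-cong refl = ≈-refl

-- Bases with two elements

comb : ℚ → ℝ → ℚ → ℝ → ℝ
comb p x q y = fromℚ p * x + fromℚ q * y

comb-comm : ∀ p x q y → comb p x q y ≈ comb q y p x
comb-comm p x q y = pointwise (λ n → ℚ.+-comm (p ℚ.* seq x n) (q ℚ.* seq y n))

comb-congˡ : ∀ {p x x′ q y} → x ≈ x′ → comb p x q y ≈ comb p x′ q y
comb-congˡ x≈x′ = ≈-+ (≈-* ≈-refl x≈x′) ≈-refl

-- The two basis elements are separate arguments, and the final `0ℝ` of `linComb` is gone, so that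
-- replacing one element is easy to state.
record Basis₂ {ℓ : Level} (K : Pred ℝ ℓ) (x y : ℝ) : Set ℓ where
  field
    x∈K         : x ∈ K
    y∈K         : y ∈ K
    span        : ∀ {z} → z ∈ K → ∃[ p ] ∃[ q ] z ≈ comb p x q y
    independent : ∀ p q → comb p x q y ≈ 0ℝ → p ≡ 0ℚ × q ≡ 0ℚ

open Basis₂

basis-swap : ∀ {ℓ} {K : Pred ℝ ℓ} {x y} → Basis₂ K x y → Basis₂ K y x
basis-swap {x = x} {y} B = record
  { x∈K = y∈K B
  ; y∈K = x∈K B
  ; span = λ z∈K → let p , q , z≈ = span B z∈K in q , p , ≈-trans z≈ (comb-comm p x q y)
  ; independent = λ p q pq≈0 → swap (independent B q p (≈-trans (comb-comm q x p y) pq≈0))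
  }

product≡0 : ∀ p q → q ≢ 0ℚ → p ℚ.* q ≡ 0ℚ → p ≡ 0ℚ
product≡0 p q q≢0 pq≡0 = let r , qr≡1 = reciprocal q≢0 in begin
  p                 ≡⟨ ℚ.*-identityʳ p ⟨
  p ℚ.* 1ℚ          ≡⟨ cong (p ℚ.*_) qr≡1 ⟨
  p ℚ.* (q ℚ.* r)   ≡⟨ ℚ.*-assoc p q r ⟨
  p ℚ.* q ℚ.* r     ≡⟨ cong (ℚ._* r) pq≡0 ⟩
  0ℚ ℚ.* r          ≡⟨ ℚ.*-zeroˡ r ⟩
  0ℚ                ∎
  where open ≡-Reasoning

-- Steinitz exchange. Every later change of basis is an instance: bringing in 1, completing the
-- square, changing the sign of the root, and passing to mγ - n.
basis-exchange : ∀ {ℓ} {K : Pred ℝ ℓ} {x y z} α β → Basis₂ K x y → z ∈ K →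
  z ≈ comb α x β y → α ≢ 0ℚ → Basis₂ K z y
basis-exchange {K = K} {x} {y} {z} α β B z∈K z≈ α≢0 = record
  { x∈K = z∈K
  ; y∈K = y∈K B
  ; span = spanning
  ; independent = independence
  }
  where
  recombine : ∀ r q α β X Y →
    (r ℚ.* α) ℚ.* X ℚ.+ q ℚ.* Y ≡ r ℚ.* (α ℚ.* X ℚ.+ β ℚ.* Y) ℚ.+ (q ℚ.- r ℚ.* β) ℚ.* Y
  recombine = solve 6 (λ r q α β X Y →
    (r :* α) :* X :+ q :* Y := r :* (α :* X :+ β :* Y) :+ (q :- r :* β) :* Y) refl
    where open +-*-Solver
  expand : ∀ p q α β X Y →
    p ℚ.* (α ℚ.* X ℚ.+ β ℚ.* Y) ℚ.+ q ℚ.* Y ≡ (p ℚ.* α) ℚ.* X ℚ.+ (p ℚ.* β ℚ.+ q) ℚ.* Y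
  expand = solve 6 (λ p q α β X Y →
    p :* (α :* X :+ β :* Y) :+ q :* Y := (p :* α) :* X :+ (p :* β :+ q) :* Y) refl
    where open +-*-Solver
  spanning : ∀ {w} → w ∈ K → ∃[ p ] ∃[ q ] w ≈ comb p z q y
  spanning {w} w∈K =
    let p , q , w≈ = span B w∈K
        s , αs≡1 = reciprocal α≢0
        r = p ℚ.* s
        p≡rα : p ≡ r ℚ.* α
        p≡rα = sym (trans (ℚ.*-assoc p s α)
          (trans (cong (p ℚ.*_) (trans (ℚ.*-comm s α) αs≡1)) (ℚ.*-identityʳ p)))
    in r , q ℚ.- r ℚ.* β ,
    (begin
      w
        ≈⟨ w≈ ⟩
      comb p x q y
        ≈⟨ pointwise (λ n → trans (cong (λ t → t ℚ.* seq x n ℚ.+ q ℚ.* seq y n) p≡rα)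
             (recombine r q α β (seq x n) (seq y n))) ⟩
      comb r (comb α x β y) (q ℚ.- r ℚ.* β) y
        ≈⟨ comb-congˡ (≈-sym z≈) ⟩
      comb r z (q ℚ.- r ℚ.* β) y ∎)
    where open ≈-Reasoning
  independence : ∀ p q → comb p z q y ≈ 0ℝ → p ≡ 0ℚ × q ≡ 0ℚ
  independence p q pq≈0 =
    let pα≡0 , pβ+q≡0 = independent B (p ℚ.* α) (p ℚ.* β ℚ.+ q) (begin
          comb (p ℚ.* α) x (p ℚ.* β ℚ.+ q) y
            ≈⟨ pointwise (λ n → sym (expand p q α β (seq x n) (seq y n))) ⟩
          comb p (comb α x β y) q y
            ≈⟨ comb-congˡ (≈-sym z≈) ⟩
          comb p z q y
            ≈⟨ pq≈0 ⟩
          0ℝ ∎)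
        p≡0 = product≡0 p α α≢0 pα≡0
    in p≡0 , trans (sym (ℚ.+-identityˡ q))
      (trans (cong (ℚ._+ q) (trans (sym (ℚ.*-zeroˡ β)) (cong (ℚ._* β) (sym p≡0)))) pβ+q≡0)
    where open ≈-Reasoning

basis⇒basis₂ : ∀ {ℓ} {K : Pred ℝ ℓ} {b : Fin 2 → ℝ} → IsℚBasis K b →
  Basis₂ K (b zero) (b (suc zero))
basis⇒basis₂ {b = b} B = record
  { x∈K = IsℚBasis.members B zero
  ; y∈K = IsℚBasis.members B (suc zero)
  ; span = λ z∈K → let a , z≃ = IsℚBasis.spanning B z∈K in
      a zero , a (suc zero) , ≈-trans (wrap z≃) (linComb≈comb a)
  ; independent = λ p q pq≈0 →
      let a≡0 = IsℚBasis.independent B (λ { zero → p ; (suc zero) → q })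
                  (unwrap (≈-trans (linComb≈comb (λ { zero → p ; (suc zero) → q })) pq≈0))
      in a≡0 zero , a≡0 (suc zero)
  }
  where
  linComb≈comb : ∀ a → linComb a b ≈ comb (a zero) (b zero) (a (suc zero)) (b (suc zero))
  linComb≈comb a = pointwise (λ n → cong (a zero ℚ.* seq (b zero) n ℚ.+_) (ℚ.+-identityʳ _))

-- The case distinction is made on the coordinates of 1, which are rational, so their vanishing is
-- decidable. Both cannot vanish, as 1 ≠ 0.
basisWith1 : ∀ {ℓ} {K : Pred ℝ ℓ} {x y} → 1ℝ ∈ K → Basis₂ K x y → ∃[ θ ] Basis₂ K θ 1ℝ
basisWith1 {x = x} {y} 1∈K B with span B 1∈K
... | p , q , 1≈ with p ℚ.≟ 0ℚ | q ℚ.≟ 0ℚ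
...   | no p≢0   | _        = y , basis-swap (basis-exchange p q B 1∈K 1≈ p≢0)
...   | yes _    | no q≢0   = x , basis-swap
  (basis-exchange q p (basis-swap B) 1∈K (≈-trans 1≈ (comb-comm p x q y)) q≢0)
...   | yes refl | yes refl = contradiction (fromℚ-injective {1ℚ} {0ℚ} (unwrap 1≈0)) λ()
  where
  1≈0 : 1ℝ ≈ 0ℝ
  1≈0 = ≈-trans 1≈ (pointwise (λ n → cong₂ ℚ._+_ (ℚ.*-zeroˡ (seq x n)) (ℚ.*-zeroˡ (seq y n))))

-- Quadratic fields as generated by the square root of an integer

module _ {ℓ} {K : Pred ℝ ℓ} (F : IsSubfield K) where

  open IsSubfield F renaming (resp-≃ to K-resp-≃)

  resp-≈ : ∀ {x y} → x ≈ y → x ∈ K → y ∈ K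
  resp-≈ {x} {y} x≈y = K-resp-≃ {x} {y} (unwrap x≈y)

  fromℕ∈K : ∀ n → fromℤ (+ n) ∈ K
  fromℕ∈K zero    = resp-≈ {0ℝ} (fromℚ-cong refl) 0-closed
  fromℕ∈K (suc n) = resp-≈ {1ℝ + fromℤ (+ n)} {fromℤ (+ suc n)}
    (pointwise (λ _ → sym (ι-+ (+ 1) (+ n)))) (+-closed 1-closed (fromℕ∈K n))

  fromℤ∈K : ∀ z → fromℤ z ∈ K
  fromℤ∈K (+ n)    = fromℕ∈K n
  fromℤ∈K -[1+ n ] = resp-≈ { - fromℤ (+ suc n)} {fromℤ -[1+ n ]}
    (pointwise (λ _ → sym (ι-neg (+ suc n)))) (neg-closed (fromℕ∈K (suc n)))

  fromℚ∈K : ∀ p → fromℚ p ∈ K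
  fromℚ∈K p =
    let r , ↧p*r≡1 = reciprocal (ι≢0 {↧ p} (↧≢0 p))
        r∈K = ⁻¹-closed {fromℤ (↧ p)} {fromℚ r}
                (unwrap (pointwise {fromℤ (↧ p) * fromℚ r} {1ℝ} (λ _ → ↧p*r≡1))) (fromℤ∈K (↧ p))
        p≡ : ι (↥ p) ℚ.* r ≡ p
        p≡ = trans (cong (ℚ._* r) (sym (ι-↥ p)))
          (trans (ℚ.*-assoc p (ι (↧ p)) r) (trans (cong (p ℚ.*_) ↧p*r≡1) (ℚ.*-identityʳ p)))
    in resp-≈ {fromℤ (↥ p) * fromℚ r} {fromℚ p} (pointwise (λ _ → p≡))
         (*-closed (fromℤ∈K (↥ p)) r∈K)
    where
    ↧≢0 : ∀ p → ↧ p ≢ ℤ.0ℤ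
    ↧≢0 p ()

  comb∈K : ∀ p {x} q {y} → x ∈ K → y ∈ K → comb p x q y ∈ K
  comb∈K p q x∈K y∈K = +-closed (*-closed (fromℚ∈K p) x∈K) (*-closed (fromℚ∈K q) y∈K)

  -- Write θ² = qθ + p and let r be the denominator of the discriminant D. Then γ = r (2θ - q) has
  -- γ² = r² D, the integer denominator times numerator.
  integralRoot : ∀ {θ} → Basis₂ K θ 1ℝ →
    ∃[ e ] ∃[ γ ] Basis₂ K γ 1ℝ × γ * γ ≈ fromℤ e
  integralRoot {θ} B with span B (*-closed (x∈K B) (x∈K B))
  ... | q , p , θ²≈ = ↧ D ℤ.* ↥ D , γ ,
    basis-exchange (r ℚ.+ r) c B (comb∈K (r ℚ.+ r) c (x∈K B) (y∈K B)) ≈-refl r+r≢0 , γ²≈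
    where
    -- D is the discriminant of X² - q X - p, and (2θ - q)² = D.
    D r c : ℚ
    D = (p ℚ.+ p) ℚ.+ (p ℚ.+ p) ℚ.+ q ℚ.* q
    r = ι (↧ D)
    c = ℚ.- (r ℚ.* q)
    γ = comb (r ℚ.+ r) θ c 1ℝ
    r+r≢0 : r ℚ.+ r ≢ 0ℚ
    r+r≢0 r+r≡0 = ι≢0 {↧ D ℤ.+ ↧ D} (λ ()) (trans (ι-+ (↧ D) (↧ D)) r+r≡0)
    expand : ∀ r q X →
      ((r ℚ.+ r) ℚ.* X ℚ.+ (ℚ.- (r ℚ.* q)) ℚ.* 1ℚ) ℚ.*
        ((r ℚ.+ r) ℚ.* X ℚ.+ (ℚ.- (r ℚ.* q)) ℚ.* 1ℚ) ≡
      ((r ℚ.+ r) ℚ.* (r ℚ.+ r)) ℚ.* (X ℚ.* X) ℚ.+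
      (((r ℚ.+ r) ℚ.* (ℚ.- (r ℚ.* q) ℚ.+ ℚ.- (r ℚ.* q))) ℚ.* X ℚ.+ (r ℚ.* q) ℚ.* (r ℚ.* q))
    expand = solve 3 (λ r q X →
      ((r :+ r) :* X :+ (:- (r :* q)) :* con 1ℚ) :* ((r :+ r) :* X :+ (:- (r :* q)) :* con 1ℚ) :=
      ((r :+ r) :* (r :+ r)) :* (X :* X) :+
      (((r :+ r) :* (:- (r :* q) :+ :- (r :* q))) :* X :+ (r :* q) :* (r :* q))) refl
      where open +-*-Solver
    collapse : ∀ r q p X → ((r ℚ.+ r) ℚ.* (r ℚ.+ r)) ℚ.* (q ℚ.* X ℚ.+ p ℚ.* 1ℚ) ℚ.+
      (((r ℚ.+ r) ℚ.* (ℚ.- (r ℚ.* q) ℚ.+ ℚ.- (r ℚ.* q))) ℚ.* X ℚ.+ (r ℚ.* q) ℚ.* (r ℚ.* q)) ≡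
      r ℚ.* (((p ℚ.+ p) ℚ.+ (p ℚ.+ p) ℚ.+ q ℚ.* q) ℚ.* r)
    collapse = solve 4 (λ r q p X →
      ((r :+ r) :* (r :+ r)) :* (q :* X :+ p :* con 1ℚ) :+
      (((r :+ r) :* (:- (r :* q) :+ :- (r :* q))) :* X :+ (r :* q) :* (r :* q)) :=
      r :* (((p :+ p) :+ (p :+ p) :+ q :* q) :* r)) refl
      where open +-*-Solver
    rest : ℝ
    rest = fromℚ ((r ℚ.+ r) ℚ.* (c ℚ.+ c)) * θ + fromℚ ((r ℚ.* q) ℚ.* (r ℚ.* q))
    γ²≈ : γ * γ ≈ fromℤ (↧ D ℤ.* ↥ D)
    γ²≈ = begin
      γ * γ
        ≈⟨ pointwise (λ n → expand r q (seq θ n)) ⟩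
      fromℚ ((r ℚ.+ r) ℚ.* (r ℚ.+ r)) * (θ * θ) + rest
        ≈⟨ ≈-+ (≈-* ≈-refl θ²≈) ≈-refl ⟩
      fromℚ ((r ℚ.+ r) ℚ.* (r ℚ.+ r)) * comb q θ p 1ℝ + rest
        ≈⟨ pointwise (λ n → collapse r q p (seq θ n)) ⟩
      fromℚ (r ℚ.* (D ℚ.* r))
        ≈⟨ fromℚ-cong (trans (cong (r ℚ.*_) (ι-↥ D)) (sym (ι-* (↧ D) (↥ D)))) ⟩
      fromℤ (↧ D ℤ.* ↥ D) ∎
      where open ≈-Reasoning

-- The positive square root

≤-byℚ : ∀ {p q} r → 0ℚ ℚ.≤ r → q ≡ p ℚ.+ r → p ℚ.≤ q
≤-byℚ {p} r 0≤r refl = subst (ℚ._≤ p ℚ.+ r) (ℚ.+-identityʳ p) (ℚ.+-monoʳ-≤ p 0≤r)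

p≤∣p∣ : ∀ p → p ℚ.≤ ℚ.∣ p ∣
p≤∣p∣ p with ℚ.≤-total 0ℚ p
... | inj₁ 0≤p = ℚ.≤-reflexive (sym (ℚ.0≤p⇒∣p∣≡p 0≤p))
... | inj₂ p≤0 = ℚ.≤-trans p≤0 (ℚ.0≤∣p∣ p)

close⇒<ʳ : ∀ p q {ε} → ℚ.∣ p ℚ.- q ∣ ℚ.< ε → p ℚ.< q ℚ.+ ε
close⇒<ʳ p q {ε} close = subst (ℚ._< q ℚ.+ ε) (restore p q)
  (ℚ.+-monoʳ-< q (ℚ.≤-<-trans (p≤∣p∣ (p ℚ.- q)) close))
  where
  restore : ∀ a b → b ℚ.+ (a ℚ.- b) ≡ a
  restore = solve 2 (λ a b → b :+ (a :- b) := a) refl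
    where open +-*-Solver

neg² : ∀ a → (ℚ.- a) ℚ.* (ℚ.- a) ≡ a ℚ.* a
neg² = solve 1 (λ a → (:- a) :* (:- a) := a :* a) refl
  where open +-*-Solver

0≤sq : ∀ p → 0ℚ ℚ.≤ p ℚ.* p
0≤sq p with ℚ.≤-total 0ℚ p
... | inj₁ 0≤p = 0≤-*ℚ 0≤p 0≤p
... | inj₂ p≤0 = subst (0ℚ ℚ.≤_) (neg² p) (0≤-*ℚ 0≤-p 0≤-p)
  where
  0≤-p = ℚ.neg-antimono-≤ p≤0

∣∣<½⇒sq≤½ : ∀ p → ℚ.∣ p ∣ ℚ.< ½ → p ℚ.* p ℚ.≤ ½
∣∣<½⇒sq≤½ p ∣p∣<½ = begin
  p ℚ.* p              ≤⟨ p≤∣p∣ (p ℚ.* p) ⟩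
  ℚ.∣ p ℚ.* p ∣        ≡⟨ ℚ.∣p*q∣≡∣p∣*∣q∣ p p ⟩
  ℚ.∣ p ∣ ℚ.* ℚ.∣ p ∣  ≤⟨ *-mono-≤ (ℚ.0≤∣p∣ p) (ℚ.0≤∣p∣ p) (ℚ.<⇒≤ ∣p∣<½) (ℚ.<⇒≤ ∣p∣<½) ⟩
  ½ ℚ.* ½              ≤⟨ *-monoˡ-≤ (ℚ.<⇒≤ (ℚ.positive⁻¹ ½)) (½≤1) ⟩
  ½ ℚ.* 1ℚ             ≡⟨⟩
  ½                    ∎
  where
  open ℚ.≤-Reasoning
  ½≤1 : ½ ℚ.≤ 1ℚ
  ½≤1 = ≤-byℚ ½ (ℚ.<⇒≤ (ℚ.positive⁻¹ ½)) refl

-- A sign change between p and q would force p² ≤ (p - q)².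
same-sign : ∀ p q → 0ℚ ℚ.< p → ½ ℚ.< p ℚ.* p → ℚ.∣ p ℚ.- q ∣ ℚ.< ½ → 0ℚ ℚ.< q
same-sign p q 0<p ½<p² close = ℚ.≰⇒> λ q≤0 → <⇒≱ℚ ½<p² (ℚ.≤-trans
  (*-mono-≤ (ℚ.<⇒≤ 0<p) (ℚ.<⇒≤ 0<p) (p≤p-q q≤0) (p≤p-q q≤0))
  (∣∣<½⇒sq≤½ (p ℚ.- q) close))
  where
  p≤p-q : q ℚ.≤ 0ℚ → p ℚ.≤ p ℚ.- q
  p≤p-q q≤0 = ≤-byℚ (ℚ.- q) (ℚ.neg-antimono-≤ q≤0) refl

-- The sign of a real is not decidable in general, but here x stays away from 0. Once the terms vary
-- by less than ½, none can cross 0, so the sign of one rational term decides.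
eventually-signed : ∀ x → Eventually (λ n → ½ ℚ.< seq x n ℚ.* seq x n) →
  Eventually (λ n → 0ℚ ℚ.< seq x n) ⊎ Eventually (λ n → 0ℚ ℚ.< ℚ.- seq x n)
eventually-signed x (M , ½<x²) with cauchy x ½ (ℚ.positive⁻¹ ½)
... | N , close with 0ℚ ℚ.<? seq x (M ℕ.⊔ N)
...   | yes 0<x = inj₁ (M ℕ.⊔ N , λ n L≤n →
  same-sign (seq x (M ℕ.⊔ N)) (seq x n) 0<x (½<x² (M ℕ.⊔ N) (ℕ.m≤m⊔n M N))
    (close (M ℕ.⊔ N) n (ℕ.m≤n⊔m M N) (ℕ.≤-trans (ℕ.m≤n⊔m M N) L≤n)))
...   | no 0≮x = inj₂ (M ℕ.⊔ N , λ n L≤n →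
  same-sign (ℚ.- seq x L) (ℚ.- seq x n) 0<-x (subst (½ ℚ.<_) (sym (neg² (seq x L))) ½<x²L)
    (subst (λ t → ℚ.∣ t ∣ ℚ.< ½) (neg-minus (seq x L) (seq x n))
      (close n L (ℕ.≤-trans (ℕ.m≤n⊔m M N) L≤n) (ℕ.m≤n⊔m M N))))
  where
  L = M ℕ.⊔ N
  ½<x²L = ½<x² L (ℕ.m≤m⊔n M N)
  neg-minus : ∀ a b → b ℚ.- a ≡ (ℚ.- a) ℚ.- (ℚ.- b)
  neg-minus = solve 2 (λ a b → b :- a := (:- a) :- (:- b)) refl
    where open +-*-Solver
  0<-x : 0ℚ ℚ.< ℚ.- seq x L
  0<-x with ℚ.<-cmp (seq x L) 0ℚ
  ... | tri< x<0 _ _ = ℚ.neg-antimono-< x<0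
  ... | tri> _ _ 0<x = contradiction 0<x 0≮x
  ... | tri≈ _ x≡0 _ = contradiction (subst (λ t → ½ ℚ.< t ℚ.* t) x≡0 ½<x²L)
    (λ ½<0 → <⇒≱ℚ ½<0 (ℚ.<⇒≤ (ℚ.positive⁻¹ ½)))

record PositiveRoot {ℓ : Level} (K : Pred ℝ ℓ) : Set ℓ where
  field
    radicand : ℕ
    root     : ℝ
    basis    : Basis₂ K root 1ℝ
    root²    : root * root ≈ fromℤ (+ radicand)
    positive : Eventually (λ n → 0ℚ ℚ.< seq root n)

square-nonNeg : ∀ {x p} → x * x ≈ fromℚ p → ¬ p ℚ.+ 1ℚ ℚ.≤ 0ℚ
square-nonNeg {x} {p} x²≈p p+1≤0 =
  let n , close = eventually⇒∃ (unwrap x²≈p 1ℚ (ℚ.positive⁻¹ 1ℚ)) in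
  <⇒≱ℚ (close⇒<ʳ (seq x n ℚ.* seq x n) p close) (ℚ.≤-trans p+1≤0 (0≤sq (seq x n)))

square≈0 : ∀ {x} → x * x ≈ 0ℝ → x ≈ 0ℝ
square≈0 {x} x²≈0 = wrap (null-cong (λ n → sym (ℚ.+-identityʳ (seq x n)))
  (null-square (null-cong (λ n → ℚ.+-identityʳ (seq x n ℚ.* seq x n)) (unwrap x²≈0))))

square-large : ∀ {x p} → x * x ≈ fromℚ p → 1ℚ ℚ.≤ p →
  Eventually (λ n → ½ ℚ.< seq x n ℚ.* seq x n)
square-large {x} {p} x²≈p 1≤p = map-eventually
  (λ n close → ℚ.≰⇒> λ x²≤½ → <⇒≱ℚ
    (close⇒<ʳ p (seq x n ℚ.* seq x n) (close-sym (seq x n ℚ.* seq x n) p close))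
    (ℚ.≤-trans (ℚ.+-monoˡ-≤ ½ x²≤½) 1≤p))
  (unwrap x²≈p ½ (ℚ.positive⁻¹ ½))

ι-negative : ∀ e → ι -[1+ e ] ℚ.+ 1ℚ ℚ.≤ 0ℚ
ι-negative e = subst (ℚ._≤ 0ℚ) (ι-+ -[1+ e ] (+ 1))
  (ι-mono-≤ { -[1+ e ] ℤ.+ + 1} {+ 0} (ℤ.+-monoˡ-≤ (+ 1) (ℤ.-≤- (z≤n {e}))))

orientRoot : ∀ {ℓ} {K : Pred ℝ ℓ} {γ} d → IsSubfield K → Basis₂ K γ 1ℝ → γ * γ ≈ fromℤ (+ d) →
  Eventually (λ n → 0ℚ ℚ.< seq γ n) ⊎ Eventually (λ n → 0ℚ ℚ.< ℚ.- seq γ n) → PositiveRoot K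
orientRoot {γ = γ} d F B γ²≈ (inj₁ γ>0) = record
  { radicand = d ; root = γ ; basis = B ; root² = γ²≈ ; positive = γ>0 }
orientRoot {γ = γ} d F B γ²≈ (inj₂ γ<0) = record
  { radicand = d ; root = - γ ; positive = γ<0
  ; basis = basis-exchange (ℚ.- 1ℚ) 0ℚ B (IsSubfield.neg-closed F (x∈K B))
      (pointwise (λ n → neg≡comb (seq γ n))) λ()
  ; root² = ≈-trans (pointwise (λ n → neg² (seq γ n))) γ²≈
  }
  where
  neg≡comb : ∀ a → ℚ.- a ≡ (ℚ.- 1ℚ) ℚ.* a ℚ.+ 0ℚ ℚ.* 1ℚ
  neg≡comb = solve 1 (λ a → :- a := (:- con 1ℚ) :* a :+ con 0ℚ :* con 1ℚ) refl
    where open +-*-Solver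

-- A negative e contradicts γ² ≥ 0, and e = 0 forces γ = 0, against independence. A positive integer
-- is at least 1, which keeps γ² above ½ and makes the sign of γ decidable.
positiveRoot : ∀ {ℓ} {K : Pred ℝ ℓ} {γ} e → IsSubfield K → Basis₂ K γ 1ℝ →
  γ * γ ≈ fromℤ e → PositiveRoot K
positiveRoot -[1+ e ] F B γ²≈ =
  contradiction (ι-negative e) (square-nonNeg {p = ι -[1+ e ]} γ²≈)
positiveRoot {γ = γ} (+ zero) F B γ²≈ =
  contradiction (proj₁ (independent B 1ℚ 0ℚ (≈-trans (pointwise identity) (square≈0 γ²≈)))) λ()
  where
  identity : ∀ n → 1ℚ ℚ.* seq γ n ℚ.+ 0ℚ ℚ.* 1ℚ ≡ seq γ n
  identity n = trans (ℚ.+-identityʳ _) (ℚ.*-identityˡ (seq γ n))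
positiveRoot {γ = γ} (+ suc d) F B γ²≈ = orientRoot (suc d) F B γ²≈ (eventually-signed γ
  (square-large {p = ι (+ suc d)} γ²≈ (ι-mono-≤ {+ 1} {+ suc d} (ℤ.+≤+ (s≤s z≤n)))))

fieldRoot : ∀ {ℓ} (K : RealQuadraticField ℓ) → PositiveRoot (elements K)
fieldRoot K =
  let F = RealQuadraticField.isSubfield K
      b , B = RealQuadraticField.degree-2 K
      θ , Bθ = basisWith1 (IsSubfield.1-closed F) (basis⇒basis₂ B)
      e , γ , Bγ , γ²≈ = integralRoot F Bθ
  in positiveRoot e F Bγ γ²≈

open PositiveRoot

-- Irrationality and rational bounds for multiples of the root

ι-square : ∀ n → ι (+ (n ℕ.* n)) ≡ ι (+ n) ℚ.* ι (+ n)
ι-square n = trans (cong ι (ℤ.pos-* n n)) (ι-* (+ n) (+ n))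

ι-radical : ∀ d m → ι (+ (d ℕ.* (m ℕ.* m))) ≡ (ι (+ m) ℚ.* ι (+ m)) ℚ.* ι (+ d)
ι-radical d m = trans (cong ι (ℤ.pos-* d (m ℕ.* m)))
  (trans (ι-* (+ d) (+ (m ℕ.* m)))
    (trans (cong (ι (+ d) ℚ.*_) (ι-square m)) (ℚ.*-comm (ι (+ d)) _)))

scaledRoot-null : ∀ {ℓ} {K : Pred ℝ ℓ} (R : PositiveRoot K) m → Null (λ n →
  (ι (+ m) ℚ.* seq (root R) n) ℚ.* (ι (+ m) ℚ.* seq (root R) n) ℚ.-
  ι (+ (radicand R ℕ.* (m ℕ.* m))))
scaledRoot-null R m = null-cong
  (λ n → trans (expand (ι (+ m)) (seq (root R) n) (ι (+ radicand R)))
    (cong (λ t → (ι (+ m) ℚ.* seq (root R) n) ℚ.* (ι (+ m) ℚ.* seq (root R) n) ℚ.- t)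
      (sym (ι-radical (radicand R) m))))
  (null-* (fromℚ (ι (+ m) ℚ.* ι (+ m))) (unwrap (root² R)))
  where
  expand : ∀ m g d → (m ℚ.* m) ℚ.* (g ℚ.* g ℚ.- d) ≡ (m ℚ.* g) ℚ.* (m ℚ.* g) ℚ.- (m ℚ.* m) ℚ.* d
  expand = solve 3 (λ m g d →
    (m :* m) :* (g :* g :- d) := (m :* g) :* (m :* g) :- (m :* m) :* d) refl
    where open +-*-Solver

-- With mγ and a nonnegative, (mγ - a)² ≤ |mγ - a| (mγ + a) = |(mγ)² - a²|. If the right side tends
-- to 0, then mγ = a, against the independence of γ and 1.
root-irrational : ∀ {ℓ} {K : Pred ℝ ℓ} (R : PositiveRoot K) → Irrational√ (radicand R)
root-irrational R a m 1≤m dm²≡a² = ι≢0 {+ m} m≢0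
  (proj₁ (independent (basis R) (ι (+ m)) (ℚ.- ι (+ a)) (wrap (null-cong identity
    (null-square (null-dominated 1ℚ (ℚ.positive⁻¹ 1ℚ) dominated (scaledRoot-null R m)))))))
  where
  γ = root R
  X : ℕ → ℚ
  X n = ι (+ m) ℚ.* seq γ n
  A = ι (+ a)
  0≤A : 0ℚ ℚ.≤ A
  0≤A = ι-mono-≤ (ℤ.+≤+ (z≤n {a}))
  m≢0 : + m ≢ ℤ.0ℤ
  m≢0 refl = contradiction 1≤m λ()
  identity : ∀ n → X n ℚ.- A ≡ (X n ℚ.+ (ℚ.- A) ℚ.* 1ℚ) ℚ.- 0ℚ
  identity n = sym (trans (ℚ.+-identityʳ _) (cong (X n ℚ.+_) (ℚ.*-identityʳ (ℚ.- A))))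
  factor : ∀ x a → (x ℚ.- a) ℚ.* (x ℚ.+ a) ≡ x ℚ.* x ℚ.- a ℚ.* a
  factor = solve 2 (λ x a → (x :- a) :* (x :+ a) := x :* x :- a :* a) refl
    where open +-*-Solver
  dominated : Eventually (λ n → ℚ.∣ (X n ℚ.- A) ℚ.* (X n ℚ.- A) ∣ ℚ.≤
    1ℚ ℚ.* ℚ.∣ X n ℚ.* X n ℚ.- ι (+ (radicand R ℕ.* (m ℕ.* m))) ∣)
  dominated = map-eventually (λ n γ>0 → bound n (ℚ.<⇒≤ (0<-*ℚ (ι-pos m 1≤m) γ>0))) (positive R)
    where
    open ℚ.≤-Reasoning
    bound : ∀ n → 0ℚ ℚ.≤ X n → _
    bound n 0≤X = begin
      ℚ.∣ (X n ℚ.- A) ℚ.* (X n ℚ.- A) ∣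
        ≡⟨ ℚ.∣p*q∣≡∣p∣*∣q∣ (X n ℚ.- A) (X n ℚ.- A) ⟩
      ℚ.∣ X n ℚ.- A ∣ ℚ.* ℚ.∣ X n ℚ.- A ∣
        ≤⟨ *-monoˡ-≤ (ℚ.0≤∣p∣ (X n ℚ.- A)) (ℚ.∣p-q∣≤∣p∣+∣q∣ (X n) A) ⟩
      ℚ.∣ X n ℚ.- A ∣ ℚ.* (ℚ.∣ X n ∣ ℚ.+ ℚ.∣ A ∣)
        ≡⟨ cong (ℚ.∣ X n ℚ.- A ∣ ℚ.*_) (cong₂ ℚ._+_ (ℚ.0≤p⇒∣p∣≡p 0≤X) (ℚ.0≤p⇒∣p∣≡p 0≤A)) ⟩
      ℚ.∣ X n ℚ.- A ∣ ℚ.* (X n ℚ.+ A)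
        ≡⟨ cong (ℚ.∣ X n ℚ.- A ∣ ℚ.*_) (ℚ.0≤p⇒∣p∣≡p (ℚ.+-mono-≤ 0≤X 0≤A)) ⟨
      ℚ.∣ X n ℚ.- A ∣ ℚ.* ℚ.∣ X n ℚ.+ A ∣
        ≡⟨ ℚ.∣p*q∣≡∣p∣*∣q∣ (X n ℚ.- A) (X n ℚ.+ A) ⟨
      ℚ.∣ (X n ℚ.- A) ℚ.* (X n ℚ.+ A) ∣
        ≡⟨ cong ℚ.∣_∣ (trans (factor (X n) A) (cong (λ t → X n ℚ.* X n ℚ.- t)
             (trans (sym (ι-square a)) (cong (λ t → ι (+ t)) (sym dm²≡a²))))) ⟩
      ℚ.∣ X n ℚ.* X n ℚ.- ι (+ (radicand R ℕ.* (m ℕ.* m))) ∣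
        ≡⟨ ℚ.*-identityˡ _ ⟨
      1ℚ ℚ.* ℚ.∣ X n ℚ.* X n ℚ.- ι (+ (radicand R ℕ.* (m ℕ.* m))) ∣ ∎
-- n + δ bounds the square root of anything above n² + 1 from below, and
-- n + 1 - δ that of anything below (n + 1)² - 1 from above.
margin : ∀ n δ → 0ℚ ℚ.≤ n → 0ℚ ℚ.< δ → (n ℚ.+ 1ℚ) ℚ.* δ ≡ ½ ℚ.* ½ →
  ∀ {u e} → 0ℚ ℚ.≤ u → n ℚ.* n ℚ.+ 1ℚ ℚ.≤ e → e ℚ.+ 1ℚ ℚ.≤ (n ℚ.+ 1ℚ) ℚ.* (n ℚ.+ 1ℚ) →
  ℚ.∣ u ℚ.* u ℚ.- e ∣ ℚ.< ½ → n ℚ.+ δ ℚ.< u × u ℚ.+ δ ℚ.< n ℚ.+ 1ℚ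
margin n δ 0≤n 0<δ [n+1]δ≡¼ {u} {e} 0≤u lower upper close =
  ℚ.≰⇒> (λ u≤n+δ → <⇒≱ℚ (close⇒<ʳ e (u ℚ.* u) (close-sym (u ℚ.* u) e close)) (begin
    u ℚ.* u ℚ.+ ½
      ≤⟨ ℚ.+-monoˡ-≤ ½ (*-mono-≤ 0≤u 0≤u u≤n+δ u≤n+δ) ⟩
    (n ℚ.+ δ) ℚ.* (n ℚ.+ δ) ℚ.+ ½
      ≤⟨ ≤-byℚ _ (ℚ.+-mono-≤ (0≤-*ℚ 0≤δ 0≤1-δ) 0≤δ) lower-identity ⟩
    n ℚ.* n ℚ.+ 1ℚ
      ≤⟨ lower ⟩
    e ∎)) ,
  ℚ.≰⇒> (λ n+1≤u+δ → <⇒≱ℚ (close⇒<ʳ (u ℚ.* u) e close) (begin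
    e ℚ.+ ½
      ≡⟨ halve e ⟩
    e ℚ.+ 1ℚ ℚ.- ½
      ≤⟨ ℚ.+-monoˡ-≤ (ℚ.- ½) upper ⟩
    (n ℚ.+ 1ℚ) ℚ.* (n ℚ.+ 1ℚ) ℚ.- ½
      ≤⟨ ≤-byℚ _ (0≤-*ℚ 0≤δ 0≤δ) upper-identity ⟩
    (n ℚ.+ (1ℚ ℚ.- δ)) ℚ.* (n ℚ.+ (1ℚ ℚ.- δ))
      ≤⟨ *-mono-≤ 0≤n+1-δ 0≤n+1-δ (n+1-δ≤ {u} n+1≤u+δ) (n+1-δ≤ {u} n+1≤u+δ) ⟩
    u ℚ.* u ∎))
  where
  open ℚ.≤-Reasoning
  0≤δ = ℚ.<⇒≤ 0<δ
  0≤1-δ : 0ℚ ℚ.≤ 1ℚ ℚ.- δ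
  0≤1-δ = subst (0ℚ ℚ.≤_) (trans (regroup n δ) (cong (λ t → 1ℚ ℚ.- ½ ℚ.* ½ ℚ.+ t ℚ.- δ) [n+1]δ≡¼))
    (ℚ.+-mono-≤ (ℚ.<⇒≤ (ℚ.positive⁻¹ (1ℚ ℚ.- ½ ℚ.* ½))) (0≤-*ℚ 0≤n 0≤δ))
    where
    regroup : ∀ n δ → 1ℚ ℚ.- ½ ℚ.* ½ ℚ.+ n ℚ.* δ ≡ 1ℚ ℚ.- ½ ℚ.* ½ ℚ.+ (n ℚ.+ 1ℚ) ℚ.* δ ℚ.- δ
    regroup = solve 2 (λ n δ → con 1ℚ :- con ½ :* con ½ :+ n :* δ :=
      con 1ℚ :- con ½ :* con ½ :+ (n :+ con 1ℚ) :* δ :- δ) refl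
      where open +-*-Solver
  0≤n+1-δ = ℚ.+-mono-≤ 0≤n 0≤1-δ
  n+1-δ≤ : ∀ {u} → n ℚ.+ 1ℚ ℚ.≤ u ℚ.+ δ → n ℚ.+ (1ℚ ℚ.- δ) ℚ.≤ u
  n+1-δ≤ {u} n+1≤u+δ = subst₂ ℚ._≤_ (ℚ.+-assoc n 1ℚ (ℚ.- δ)) (cancel u δ)
    (ℚ.+-monoˡ-≤ (ℚ.- δ) n+1≤u+δ)
    where
    cancel : ∀ u δ → u ℚ.+ δ ℚ.- δ ≡ u
    cancel = solve 2 (λ u δ → u :+ δ :- δ := u) refl
      where open +-*-Solver
  halve : ∀ e → e ℚ.+ ½ ≡ e ℚ.+ 1ℚ ℚ.- ½
  halve = solve 1 (λ e → e :+ con ½ := e :+ con 1ℚ :- con ½) refl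
    where open +-*-Solver
  lower-identity : n ℚ.* n ℚ.+ 1ℚ ≡ (n ℚ.+ δ) ℚ.* (n ℚ.+ δ) ℚ.+ ½ ℚ.+ (δ ℚ.* (1ℚ ℚ.- δ) ℚ.+ δ)
  lower-identity = trans (cong (λ t → n ℚ.* n ℚ.+ ((t ℚ.+ t) ℚ.+ ½)) (sym [n+1]δ≡¼)) (identity n δ)
    where
    identity : ∀ n δ →
      n ℚ.* n ℚ.+ (((n ℚ.+ 1ℚ) ℚ.* δ ℚ.+ (n ℚ.+ 1ℚ) ℚ.* δ) ℚ.+ ½) ≡
      (n ℚ.+ δ) ℚ.* (n ℚ.+ δ) ℚ.+ ½ ℚ.+ (δ ℚ.* (1ℚ ℚ.- δ) ℚ.+ δ)
    identity = solve 2 (λ n δ →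
      n :* n :+ (((n :+ con 1ℚ) :* δ :+ (n :+ con 1ℚ) :* δ) :+ con ½) :=
      (n :+ δ) :* (n :+ δ) :+ con ½ :+ (δ :* (con 1ℚ :- δ) :+ δ)) refl
      where open +-*-Solver
  upper-identity : (n ℚ.+ (1ℚ ℚ.- δ)) ℚ.* (n ℚ.+ (1ℚ ℚ.- δ)) ≡
    (n ℚ.+ 1ℚ) ℚ.* (n ℚ.+ 1ℚ) ℚ.- ½ ℚ.+ δ ℚ.* δ
  upper-identity = trans (identity n δ)
    (cong (λ t → (n ℚ.+ 1ℚ) ℚ.* (n ℚ.+ 1ℚ) ℚ.- (t ℚ.+ t) ℚ.+ δ ℚ.* δ) [n+1]δ≡¼)
    where
    identity : ∀ n δ → (n ℚ.+ (1ℚ ℚ.- δ)) ℚ.* (n ℚ.+ (1ℚ ℚ.- δ)) ≡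
      (n ℚ.+ 1ℚ) ℚ.* (n ℚ.+ 1ℚ) ℚ.- ((n ℚ.+ 1ℚ) ℚ.* δ ℚ.+ (n ℚ.+ 1ℚ) ℚ.* δ) ℚ.+ δ ℚ.* δ
    identity = solve 2 (λ n δ → (n :+ (con 1ℚ :- δ)) :* (n :+ (con 1ℚ :- δ)) :=
      (n :+ con 1ℚ) :* (n :+ con 1ℚ) :- ((n :+ con 1ℚ) :* δ :+ (n :+ con 1ℚ) :* δ) :+ δ :* δ) refl
      where open +-*-Solver

-- The integer e is at distance at least 1 from n² and (n + 1)². Half of this pays for the error ½
-- in u², and 2 (n + 1) δ = ½ lets the other half pay for the shift by δ. This δ depends on n alone,
-- as `_<_` asks for one δ for all late terms.
gap : ∀ {n} → 0ℚ ℚ.≤ n → ∃[ δ ] 0ℚ ℚ.< δ × (n ℚ.+ 1ℚ) ℚ.* δ ≡ ½ ℚ.* ½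
gap {n} 0≤n =
  let r , 0<r , [n+1]r≡1 = reciprocal-pos (ℚ.+-mono-≤-< 0≤n (ℚ.positive⁻¹ 1ℚ)) in
  r ℚ.* (½ ℚ.* ½) , 0<-*ℚ 0<r (ℚ.positive⁻¹ (½ ℚ.* ½)) ,
  trans (sym (ℚ.*-assoc (n ℚ.+ 1ℚ) r (½ ℚ.* ½)))
    (trans (cong (ℚ._* (½ ℚ.* ½)) [n+1]r≡1) (ℚ.*-identityˡ (½ ℚ.* ½)))

ι-suc : ∀ n → ι (+ suc n) ≡ ι (+ n) ℚ.+ 1ℚ
ι-suc n = trans (ι-+ (+ 1) (+ n)) (ℚ.+-comm 1ℚ (ι (+ n)))

-- Primitive elements in the unit interval

basis⇒primitive : ∀ {ℓ} {K : Pred ℝ ℓ} {α} → IsSubfield K → Basis₂ K α 1ℝ → K ≐ ℚ⟮ α ⟯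
basis⇒primitive {K = K} {α} F B = K⊆ , ⊆K
  where
  K⊆ : K ⊆ ℚ⟮ α ⟯
  K⊆ {x} x∈K′ = let p , q , x≈ = span B x∈K′ in
    resp-≃ {x = comb p α q 1ℝ} {x} (unwrap (≈-sym x≈))
      (plus (times (rational p) generator) (times (rational q) (rational 1ℚ)))
  ⊆K : ℚ⟮ α ⟯ ⊆ K
  ⊆K generator                = x∈K B
  ⊆K (rational q)             = fromℚ∈K F q
  ⊆K (resp-≃ {x} {y} x≃y x∈)  = IsSubfield.resp-≃ F {x} {y} x≃y (⊆K x∈)
  ⊆K (plus x∈ y∈)             = IsSubfield.+-closed F (⊆K x∈) (⊆K y∈)
  ⊆K (negate x∈)              = IsSubfield.neg-closed F (⊆K x∈)
  ⊆K (times x∈ y∈)            = IsSubfield.*-closed F (⊆K x∈) (⊆K y∈)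
  ⊆K (inverse {x} {y} xy≃1 x∈) = IsSubfield.⁻¹-closed F {x} {y} xy≃1 (⊆K x∈)

primitiveElement : ∀ {ℓ} (K : RealQuadraticField ℓ) (R : PositiveRoot (elements K)) n m →
  n ℕ.* n ℕ.< radicand R ℕ.* (m ℕ.* m) → radicand R ℕ.* (m ℕ.* m) ℕ.< suc n ℕ.* suc n →
  ∃[ α ] α ∈ I²ʳ (2 ℕ.* n) × IsPrimitiveElement α K
primitiveElement K R n m n²<E E<[n+1]² =
  α , ((0<α , α<1) , c , (-2n≤c , c≤-1) , unwrap α²+2nα+c≈0) ,
  basis⇒primitive F (basis-exchange M (ℚ.- N) (basis R)
    (comb∈K F M (ℚ.- N) (x∈K (basis R)) (y∈K (basis R))) ≈-refl (ι≢0 {+ m} m≢0))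
  where
  F = RealQuadraticField.isSubfield K
  γ = root R
  E = radicand R ℕ.* (m ℕ.* m)
  M N D : ℚ
  M = ι (+ m)
  N = ι (+ n)
  D = ι (+ radicand R)
  α = comb M γ (ℚ.- N) 1ℝ
  -- The constant term n² - dm² of the polynomial of mγ - n. By integrality, n² < dm² gives c ≤ -1,
  -- and dm² < (n + 1)² gives c ≥ -2n.
  c = + (n ℕ.* n) ℤ.- + E
  0<m : 1 ℕ.≤ m
  0<m = ℕ.n≢0⇒n>0 λ { refl →
    contradiction (subst (n ℕ.* n ℕ.<_) (ℕ.*-zeroʳ (radicand R)) n²<E) λ() }
  m≢0 : + m ≢ ℤ.0ℤ
  m≢0 refl = contradiction 0<m λ()

  c≤-1 : c ℤ.≤ -1ℤ
  c≤-1 = ≤-by _ (ℤ.i≤j⇒0≤j-i (ℤ.+≤+ n²<E)) (identity (+ (n ℕ.* n)) (+ E))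
    where
    identity : ∀ x y → -1ℤ ≡ (x ℤ.- y) ℤ.+ (y ℤ.- (1ℤ ℤ.+ x))
    identity = solve-∀
  [n+1]²≡ : + (suc n ℕ.* suc n) ≡ + (n ℕ.* n) ℤ.+ + (2 ℕ.* n) ℤ.+ 1ℤ
  [n+1]²≡ = trans (ℤ.pos-* (suc n) (suc n)) (trans (expand (+ n))
    (sym (cong₂ (λ x y → x ℤ.+ y ℤ.+ 1ℤ) (ℤ.pos-* n n) (ℤ.pos-* 2 n))))
    where
    expand : ∀ x → (1ℤ ℤ.+ x) ℤ.* (1ℤ ℤ.+ x) ≡ x ℤ.* x ℤ.+ + 2 ℤ.* x ℤ.+ 1ℤ
    expand = solve-∀
  -2n≤c : ℤ.- + (2 ℕ.* n) ℤ.≤ c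
  -2n≤c = ≤-by _ (ℤ.i≤j⇒0≤j-i (subst (1ℤ ℤ.+ + E ℤ.≤_) [n+1]²≡ (ℤ.+≤+ E<[n+1]²)))
    (identity (+ (n ℕ.* n)) (+ E) (+ (2 ℕ.* n)))
    where
    identity : ∀ x y t → x ℤ.- y ≡ (ℤ.- t) ℤ.+ ((x ℤ.+ t ℤ.+ 1ℤ) ℤ.- (1ℤ ℤ.+ y))
    identity = solve-∀

  0≤N : 0ℚ ℚ.≤ N
  0≤N = ι-mono-≤ (ℤ.+≤+ (z≤n {n}))
  N²+1≤E : N ℚ.* N ℚ.+ 1ℚ ℚ.≤ ι (+ E)
  N²+1≤E = subst (ℚ._≤ ι (+ E))
    (trans (ι-suc (n ℕ.* n)) (cong (ℚ._+ 1ℚ) (ι-square n)))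
    (ι-mono-≤ (ℤ.+≤+ n²<E))
  E+1≤[N+1]² : ι (+ E) ℚ.+ 1ℚ ℚ.≤ (N ℚ.+ 1ℚ) ℚ.* (N ℚ.+ 1ℚ)
  E+1≤[N+1]² = subst₂ ℚ._≤_ (ι-suc E)
    (trans (ι-square (suc n)) (cong (λ t → t ℚ.* t) (ι-suc n)))
    (ι-mono-≤ (ℤ.+≤+ E<[n+1]²))

  δ = proj₁ (gap 0≤N)
  0<δ : 0ℚ ℚ.< δ
  0<δ = proj₁ (proj₂ (gap 0≤N))
  between : Eventually (λ j → N ℚ.+ δ ℚ.< M ℚ.* seq γ j × M ℚ.* seq γ j ℚ.+ δ ℚ.< N ℚ.+ 1ℚ)
  between = zip-eventually
    (λ j γ>0 close → margin N δ 0≤N 0<δ (proj₂ (proj₂ (gap 0≤N)))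
      (ℚ.<⇒≤ (0<-*ℚ (ι-pos m 0<m) γ>0)) N²+1≤E E+1≤[N+1]² close)
    (positive R) (scaledRoot-null R m ½ (ℚ.positive⁻¹ ½))
  0<α : 0ℝ < α
  0<α = δ , 0<δ , map-eventually (λ j (N+δ<u , _) →
    subst₂ ℚ._<_ (shift N δ) (cong (M ℚ.* seq γ j ℚ.+_) (sym (ℚ.*-identityʳ (ℚ.- N))))
      (ℚ.+-monoˡ-< (ℚ.- N) N+δ<u)) between
    where
    shift : ∀ N δ → N ℚ.+ δ ℚ.+ (ℚ.- N) ≡ 0ℚ ℚ.+ δ
    shift = solve 2 (λ N δ → N :+ δ :+ (:- N) := con 0ℚ :+ δ) refl
      where open +-*-Solver
  α<1 : α < 1ℝ
  α<1 = δ , 0<δ , map-eventually (λ j (_ , u+δ<) →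
    subst₂ ℚ._<_ (shift (M ℚ.* seq γ j) N δ) (cancel N) (ℚ.+-monoˡ-< (ℚ.- N) u+δ<)) between
    where
    shift : ∀ u N δ → u ℚ.+ δ ℚ.+ (ℚ.- N) ≡ u ℚ.+ (ℚ.- N) ℚ.* 1ℚ ℚ.+ δ
    shift = solve 3 (λ u N δ → u :+ δ :+ (:- N) := u :+ (:- N) :* con 1ℚ :+ δ) refl
      where open +-*-Solver
    cancel : ∀ N → N ℚ.+ 1ℚ ℚ.+ (ℚ.- N) ≡ 1ℚ
    cancel = solve 1 (λ N → N :+ con 1ℚ :+ (:- N) := con 1ℚ) refl
      where open +-*-Solver

  2N≡ : ι (+ (2 ℕ.* n)) ≡ N ℚ.+ N
  2N≡ = trans (cong ι (trans (cong (λ t → + (n ℕ.+ t)) (ℕ.+-identityʳ n)) (ℤ.pos-+ n n)))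
    (ι-+ (+ n) (+ n))
  c≡ : ι c ≡ N ℚ.* N ℚ.- (M ℚ.* M) ℚ.* D
  c≡ = trans (ι-+ (+ (n ℕ.* n)) (ℤ.- + E))
    (cong₂ ℚ._+_ (ι-square n) (trans (ι-neg (+ E)) (cong ℚ.-_ (ι-radical (radicand R) m))))
  α²+2nα+c≈0 : α * α + fromℤ (+ (2 ℕ.* n)) * α + fromℤ c ≈ 0ℝ
  α²+2nα+c≈0 = begin
    α * α + fromℤ (+ (2 ℕ.* n)) * α + fromℤ c
      ≈⟨ ≈-+ (≈-+ ≈-refl (≈-* (fromℚ-cong 2N≡) ≈-refl)) (fromℚ-cong c≡) ⟩
    α * α + fromℚ (N ℚ.+ N) * α + fromℚ (N ℚ.* N ℚ.- (M ℚ.* M) ℚ.* D)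
      ≈⟨ pointwise (λ j → complete-square M N D (seq γ j)) ⟩
    fromℚ (M ℚ.* M) * (γ * γ) + fromℚ (ℚ.- ((M ℚ.* M) ℚ.* D))
      ≈⟨ ≈-+ (≈-* ≈-refl (root² R)) ≈-refl ⟩
    fromℚ (M ℚ.* M) * fromℚ D + fromℚ (ℚ.- ((M ℚ.* M) ℚ.* D))
      ≈⟨ pointwise (λ _ → ℚ.+-inverseʳ ((M ℚ.* M) ℚ.* D)) ⟩
    0ℝ ∎
    where
    open ≈-Reasoning
    complete-square : ∀ M N D g →
      (M ℚ.* g ℚ.+ (ℚ.- N) ℚ.* 1ℚ) ℚ.* (M ℚ.* g ℚ.+ (ℚ.- N) ℚ.* 1ℚ) ℚ.+
      (N ℚ.+ N) ℚ.* (M ℚ.* g ℚ.+ (ℚ.- N) ℚ.* 1ℚ) ℚ.+ (N ℚ.* N ℚ.- (M ℚ.* M) ℚ.* D) ≡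
      (M ℚ.* M) ℚ.* (g ℚ.* g) ℚ.+ (ℚ.- ((M ℚ.* M) ℚ.* D))
    complete-square = solve 4 (λ M N D g →
      (M :* g :+ (:- N) :* con 1ℚ) :* (M :* g :+ (:- N) :* con 1ℚ) :+
      (N :+ N) :* (M :* g :+ (:- N) :* con 1ℚ) :+ (N :* N :- (M :* M) :* D) :=
      (M :* M) :* (g :* g) :+ (:- ((M :* M) :* D))) refl
      where open +-*-Solver

theorem4 : ∀ {ℓ} (k : ℕ) → 1 ℕ.≤ k →
    (K : Fin k → RealQuadraticField ℓ) →
    (∀ i j → i ≢ j → ¬ (elements (K i) ≐ elements (K j))) →
    ∃[ n ] 1 ℕ.≤ n × (∀ i → ∃[ α ] α ∈ I²ʳ (2 ℕ.* n) × IsPrimitiveElement α (K i))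
theorem4 (suc k) _ K _ =
  let R i = fieldRoot (K i)
      n , 1≤n , inside = commonInterval (λ i → radicand (R i)) (λ i → root-irrational (R i))
  in n , 1≤n , λ i → let m , n²<dm² , dm²<[n+1]² = inside i in
    primitiveElement (K i) (R i) n m n²<dm² dm²<[n+1]²
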